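{- Let $r\ge3$ be an odd integer with $r\neq5$. Then every $2$-edge-connected $r$-regular graph admits a $0$-sum $3$-flow.
   Context: For a positive integer $k$ and a real $c$, a $c$-sum $k$-flow on a graph $G=(V,E)$ is a function $\omega:E\to\{\pm1,\ldots,\pm(k-1)\}$ such that $\sum_{e\ni v}\omega(e)=c$ for every vertex $v$. (So a $0$-sum $3$-flow uses values in $\{\pm1,\pm2\}$ and has sum $0$ at every vertex.) -}

module Defs where

open import Data.Nat using (ℕ; zero; suc; _+_; _*_)
open import Data.Integer as ℤ using (ℤ; ∣_∣)
open import Data.Fin using (Fin; zero; suc; _≟_)
open import Data.Product using (_×_; _,_; proj₁; proj₂; ∃)
open import Data.Bool using (Bool; true; false; if_then_else_; _∨_)
open import Relation.Nullary using (¬_; does)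
open import Relation.Binary.PropositionalEquality using (_≡_)

-- A finite loopless multigraph with vertex set Fin n and edge set Fin m;
-- each edge has two (distinct) endpoints.  Parallel edges are allowed.
record Graph : Set where
  field
    n     : ℕ
    m     : ℕ
    ends  : Fin m → Fin n × Fin n
    loopless : ∀ e → ¬ (proj₁ (ends e) ≡ proj₂ (ends e))

open Graph public

∑ℕ : ∀ {k} → (Fin k → ℕ) → ℕ
∑ℕ {zero}  f = 0
∑ℕ {suc k} f = f zero + ∑ℕ (λ i → f (suc i))

∑ℤ : ∀ {k} → (Fin k → ℤ) → ℤ
∑ℤ {zero}  f = ℤ.0ℤ
∑ℤ {suc k} f = f zero ℤ.+ ∑ℤ (λ i → f (suc i))

incident : (G : Graph) → Fin (m G) → Fin (n G) → Bool
incident G e v = does (proj₁ (ends G e) ≟ v) ∨ does (proj₂ (ends G e) ≟ v)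

degree : (G : Graph) → Fin (n G) → ℕ
degree G v = ∑ℕ (λ e → if incident G e v then 1 else 0)

Regular : ℕ → Graph → Set
Regular r G = ∀ v → degree G v ≡ r

data Walk (G : Graph) (ok : Fin (m G) → Set) : Fin (n G) → Fin (n G) → Set where
  here : ∀ {v} → Walk G ok v v
  fwd  : ∀ {w} e → ok e → Walk G ok (proj₂ (ends G e)) w → Walk G ok (proj₁ (ends G e)) w
  bwd  : ∀ {w} e → ok e → Walk G ok (proj₁ (ends G e)) w → Walk G ok (proj₂ (ends G e)) w

ConnectedOn : (G : Graph) → (Fin (m G) → Set) → Set
ConnectedOn G ok = ∀ u v → Walk G ok u v

Connected : Graph → Set
Connected G = ConnectedOn G (λ _ → Data.Unit.⊤)
  where import Data.Unit

TwoEdgeConnected : Graph → Set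
TwoEdgeConnected G = Connected G × (∀ f → ConnectedOn G (λ e → ¬ (e ≡ f)))

IsSumFlow : (G : Graph) → ℤ → ℕ → (Fin (m G) → ℤ) → Set
IsSumFlow G c k ω =
  (∀ e → 1 Data.Nat.≤ ∣ ω e ∣ × ∣ ω e ∣ Data.Nat.< k) ×
  (∀ v → ∑ℤ (λ e → if incident G e v then ω e else ℤ.0ℤ) ≡ c)
  where import Data.Nat

HasZeroSumFlow : ℕ → Graph → Set
HasZeroSumFlow k G = ∃ λ ω → IsSumFlow G ℤ.0ℤ k ω

Odd : ℕ → Set
Odd r = ∃ λ t → r ≡ 2 * t + 1

{-# OPTIONS --safe #-}
module Submission where

-- Write r = 6a + 4b + 3, which is possible exactly when r ≠ 1, 5. If G has a (2a + 2b + 1)-factor F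
-- and its complement has a 2b-factor D, then ω = 2 on F, −2 on D and −1 elsewhere is a 0-sum flow.
--
-- An s-factor of an (s + c)-regular graph is a perfect matching of the graph in which each vertex
-- is replaced by a complete bipartite graph between its edge ends and c new vertices. Giving the
-- original edges multiplicity s makes that graph regular of degree s + c, and for c even all its
-- odd cuts have size at least s + c as soon as every odd cut of the original graph has at least
-- (s + c) / s edges. For F this holds because an odd cut of a 2-edge-connected graph has at least
-- three edges, and r ≤ 3 (2a + 2b + 1); for D there are no odd cuts.
--
-- A regular graph of degree r whose odd cuts all have size at least r has a perfect matching:
-- otherwise let U be maximal such that every matching of G − U misses more than |U| vertices. By
-- maximality every vertex outside U is missed by some maximum matching of G − U, and then
-- (Gallai) "not missed by a common maximum matching" is an equivalence relation. Its classes are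
-- odd, have all outgoing edges in U and number at least |U| + 2, too many for the r |U| edge ends
-- at U.

open import Defs
open import Data.Nat using (ℕ; zero; suc; _+_; _*_; _≤_; _<_; z≤n; s≤s; _<?_; >-nonZero; parity)
open import Data.Nat.Properties hiding (_≟_; <-cmp)
open import Data.Nat.Tactic.RingSolver using (solve-∀)
open import Data.Integer as ℤ using (ℤ; _⊖_) renaming (+_ to fromℕ)
open import Data.Integer.Properties using (m-n≡m⊖n; n⊖n≡0)
import Data.Integer.Tactic.RingSolver as ℤRing
open import Data.Bool using (Bool; true; false; not; if_then_else_; _∧_; _∨_; _xor_)
open import Data.Bool.Properties using (xor-comm; xor-same; not-involutive; ∧-identityʳ)
open import Data.Fin as Fin using (Fin; zero; suc; _≟_; splitAt; remQuot)
open import Data.Fin.Permutation using (permutation)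
open import Data.Fin.Properties using (any?; all?; sequence; <-cmp; +↔⊎; *↔×; 2↔Bool)
open import Data.Parity.Base as ℙ using (0ℙ; 1ℙ)
open import Data.Parity.Properties using (+-homo-+; *-homo-*; p+p≡0ℙ; p≢p⁻¹)
  renaming (+-identityʳ to ℙ-+-identityʳ)
open import Data.Product as Product using (_×_; _,_; proj₁; proj₂; ∃; ∃-syntax; ∃₂)
open import Data.Product.Function.NonDependent.Propositional using (_×-↔_)
open import Data.Sum as Sum using (_⊎_; inj₁; inj₂)
open import Data.Sum.Function.Propositional using (_⊎-↔_)
open import Data.Empty using (⊥)
open import Data.Vec using (Vec; []; _∷_; lookup; tabulate)
open import Data.Vec.Properties using (lookup∘tabulate)
open import Effect.Monad using (RawMonad)
open import Function using (_∘_; id; _↔_; Inverse)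
open import Function.Construct.Composition using (_↔-∘_)
open import Function.Construct.Identity using (↔-id)
open import Relation.Nullary using (¬_; Dec; yes; no; does; contradiction)
open import Relation.Nullary.Decidable using (dec-true; dec-false; ¬¬-excluded-middle; map′; _×-dec_; ¬?)
open import Relation.Nullary.Negation using (¬¬-Monad)
open import Relation.Binary.Definitions using (tri<; tri≈; tri>)
open import Relation.Binary.PropositionalEquality
open import Algebra.Properties.Semiring.Sum +-*-semiring
  using (sum; sum-cong-≗; ∑-distrib-+; ∑-comm; sum-permute; *-distribˡ-sum; *-distribʳ-sum)

-- Finite sums and indicators

⟦_⟧ : Bool → ℕ
⟦ b ⟧ = if b then 1 else 0

δ : ∀ {n} → Fin n → Fin n → ℕ
δ i j = ⟦ does (i ≟ j) ⟧

⟦⟧≤1 : ∀ b → ⟦ b ⟧ ≤ 1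
⟦⟧≤1 false = z≤n
⟦⟧≤1 true  = s≤s z≤n

δ-refl : ∀ {n} (i : Fin n) → δ i i ≡ 1
δ-refl i rewrite dec-true (i ≟ i) refl = refl

δ-≢ : ∀ {n} {i j : Fin n} → i ≢ j → δ i j ≡ 0
δ-≢ {i = i} {j} i≢j rewrite dec-false (i ≟ j) i≢j = refl

sum-zero : ∀ {n} {f : Fin n → ℕ} → (∀ i → f i ≡ 0) → sum f ≡ 0
sum-zero {zero}  h = refl
sum-zero {suc n} h = cong₂ _+_ (h zero) (sum-zero (h ∘ suc))

sum-const : ∀ n k → sum {n} (λ _ → k) ≡ n * k
sum-const zero    k = refl
sum-const (suc n) k = cong (k +_) (sum-const n k)

sum-mono : ∀ {n} {f g : Fin n → ℕ} → (∀ i → f i ≤ g i) → sum f ≤ sum g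
sum-mono {zero}  h = z≤n
sum-mono {suc n} h = +-mono-≤ (h zero) (sum-mono (h ∘ suc))

term≤sum : ∀ {n} (f : Fin n → ℕ) i → f i ≤ sum f
term≤sum f zero    = m≤m+n _ _
term≤sum f (suc i) = ≤-trans (term≤sum (f ∘ suc) i) (m≤n+m _ _)

sum-δ* : ∀ {n} (i : Fin n) (f : Fin n → ℕ) → sum (λ j → δ i j * f j) ≡ f i
sum-δ* {suc n} zero f = trans
  (cong₂ _+_ (*-identityˡ (f zero)) (sum-zero {n} {λ j → δ zero (suc j) * f (suc j)} λ _ → refl))
  (+-identityʳ _)
sum-δ* (suc i) f = trans (sum-cong-≗ shift) (sum-δ* i (f ∘ suc))
  where
  shift : ∀ j → δ (suc i) (suc j) * f (suc j) ≡ δ i j * f (suc j)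
  shift j with i ≟ j
  ... | yes _ = refl
  ... | no  _ = refl

sum-δ : ∀ {n} (i : Fin n) → sum (δ i) ≡ 1
sum-δ i = trans (sum-cong-≗ λ j → sym (*-identityʳ (δ i j))) (sum-δ* i (λ _ → 1))

sum-parity : ∀ {n} {f g : Fin n → ℕ} → (∀ i → parity (f i) ≡ parity (g i)) →
             parity (sum f) ≡ parity (sum g)
sum-parity {zero}          h = refl
sum-parity {suc n} {f} {g} h = begin
  parity (f zero + sum (f ∘ suc))            ≡⟨ +-homo-+ (f zero) _ ⟩
  parity (f zero) ℙ.+ parity (sum (f ∘ suc)) ≡⟨ cong₂ ℙ._+_ (h zero) (sum-parity (h ∘ suc)) ⟩
  parity (g zero) ℙ.+ parity (sum (g ∘ suc)) ≡⟨ +-homo-+ (g zero) _ ⟨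
  parity (g zero + sum (g ∘ suc))            ∎
  where open ≡-Reasoning

count-unique : ∀ {n} (p : Fin n → Bool) →
               (∀ i j → p i ≡ true → p j ≡ true → i ≡ j) → sum (⟦_⟧ ∘ p) ≤ 1
count-unique p unique with any? (λ i → p i Data.Bool.≟ true)
... | yes (i , pi) = ≤-trans (sum-mono below) (≤-reflexive (sum-δ i))
  where
  below : ∀ j → ⟦ p j ⟧ ≤ δ i j
  below j with p j in pj
  ... | false = z≤n
  ... | true rewrite unique i j pi pj | δ-refl j = ≤-refl
... | no none = ≤-trans (≤-reflexive (sum-zero none′)) z≤n
  where
  none′ : ∀ j → ⟦ p j ⟧ ≡ 0
  none′ j with p j in pj
  ... | false = refl
  ... | true = contradiction (j , pj) none

-- Involutions and their fixed points.

Involutive : ∀ {n} → (Fin n → Fin n) → Set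
Involutive σ = ∀ p → σ (σ p) ≡ p

sum-involution : ∀ {n} {σ : Fin n → Fin n} → Involutive σ → ∀ f → sum f ≡ sum (f ∘ σ)
sum-involution {σ = σ} inv f = sum-permute f (permutation σ σ inv inv)

fixed : ∀ {n} → (Fin n → Fin n) → Fin n → ℕ
fixed σ p = δ (σ p) p

#fixed : ∀ {n} → (Fin n → Fin n) → ℕ
#fixed σ = sum (fixed σ)

-- The points moved upwards and those moved downwards are exchanged by σ.
invariant-parity : ∀ {n} {σ : Fin n → Fin n} → Involutive σ →
  (f : Fin n → ℕ) → (∀ i → f (σ i) ≡ f i) →
  parity (sum f) ≡ parity (sum (λ i → f i * fixed σ i))
invariant-parity {n} {σ} inv f f-inv = begin
  parity (sum f)                       ≡⟨ cong parity (sum-cong-≗ split) ⟩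
  parity (sum (λ i → a i + (b i + c i)))
    ≡⟨ cong parity (trans (∑-distrib-+ a _) (cong (sum a +_) (∑-distrib-+ b c))) ⟩
  parity (sum a + (sum b + sum c))     ≡⟨ cong (λ k → parity (sum a + (sum b + k))) c≡b ⟩
  parity (sum a + (sum b + sum b))     ≡⟨ +-homo-+ (sum a) _ ⟩
  parity (sum a) ℙ.+ parity (sum b + sum b)
    ≡⟨ cong (parity (sum a) ℙ.+_) (trans (+-homo-+ (sum b) _) (p+p≡0ℙ (parity (sum b)))) ⟩
  parity (sum a) ℙ.+ 0ℙ                ≡⟨ ℙ-+-identityʳ _ ⟩
  parity (sum a)                       ∎
  where
  open ≡-Reasoning
  a b c : Fin n → ℕ
  a i = f i * fixed σ i
  b i = f i * ⟦ does (σ i Fin.<? i) ⟧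
  c i = f i * ⟦ does (i Fin.<? σ i) ⟧
  split : ∀ i → f i ≡ a i + (b i + c i)
  split i with <-cmp (σ i) i
  ... | tri< lt ne ge rewrite dec-false (σ i ≟ i) ne | dec-true (σ i Fin.<? i) lt
                            | dec-false (i Fin.<? σ i) ge = lem (f i)
    where lem : ∀ x → x ≡ x * 0 + (x * 1 + x * 0)
          lem = solve-∀
  ... | tri≈ nl eq ge rewrite dec-true (σ i ≟ i) eq | dec-false (σ i Fin.<? i) nl
                            | dec-false (i Fin.<? σ i) ge = lem (f i)
    where lem : ∀ x → x ≡ x * 1 + (x * 0 + x * 0)
          lem = solve-∀
  ... | tri> nl ne gt rewrite dec-false (σ i ≟ i) ne | dec-false (σ i Fin.<? i) nl
                            | dec-true (i Fin.<? σ i) gt = lem (f i)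
    where lem : ∀ x → x ≡ x * 0 + (x * 0 + x * 1)
          lem = solve-∀
  c≡b : sum c ≡ sum b
  c≡b = trans (sum-involution inv c) (sum-cong-≗ λ i →
    cong₂ _*_ (f-inv i) (cong (λ j → ⟦ does (σ i Fin.<? j) ⟧) (inv i)))

-- Augmentation step for a missed `x`: `y` gives up its partner for `x`, and that partner is left
-- missed. Testing `p ≟ y` before `p ≟ N y` lets the same definition serve when `y` is itself
-- missed.
link : ∀ {n} → (Fin n → Fin n) → Fin n → Fin n → Fin n → Fin n
link N x y p with p ≟ x
... | yes _ = y
... | no  _ with p ≟ y
...   | yes _ = x
...   | no  _ with p ≟ N y
...     | yes _ = p
...     | no  _ = N p

module Link {n : ℕ} {N : Fin n → Fin n} (inv : Involutive N) {x y : Fin n}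
            (Nx≡x : N x ≡ x) (y≢x : y ≢ x) where

  N′ : Fin n → Fin n
  N′ = link N x y

  link-x : N′ x ≡ y
  link-x with x ≟ x
  ... | yes _  = refl
  ... | no x≢x = contradiction refl x≢x

  link-y : N′ y ≡ x
  link-y with y ≟ x
  ... | yes y≡x = y≡x
  ... | no _ with y ≟ y
  ...   | yes _  = refl
  ...   | no y≢y = contradiction refl y≢y

  link-freed : ∀ {p} → p ≢ x → p ≢ y → p ≡ N y → N′ p ≡ p
  link-freed {p} p≢x p≢y p≡Ny with p ≟ x
  ... | yes p≡x = contradiction p≡x p≢x
  ... | no _ with p ≟ y
  ...   | yes p≡y = contradiction p≡y p≢y
  ...   | no _ with p ≟ N y
  ...     | yes _   = refl
  ...     | no p≢Ny = contradiction p≡Ny p≢Ny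

  link-other : ∀ {p} → p ≢ x → p ≢ y → p ≢ N y → N′ p ≡ N p
  link-other {p} p≢x p≢y p≢Ny with p ≟ x
  ... | yes p≡x = contradiction p≡x p≢x
  ... | no _ with p ≟ y
  ...   | yes p≡y = contradiction p≡y p≢y
  ...   | no _ with p ≟ N y
  ...     | yes p≡Ny = contradiction p≡Ny p≢Ny
  ...     | no _     = refl

  -- Flattens the nested tests of `link`, so that a proof splits once and then uses the four lemmas
  -- above.
  data View (p : Fin n) : Set where
    at-x  : p ≡ x → View p
    at-y  : p ≢ x → p ≡ y → View p
    freed : p ≢ x → p ≢ y → p ≡ N y → View p
    other : p ≢ x → p ≢ y → p ≢ N y → View p

  view : ∀ p → View p
  view p with p ≟ x | p ≟ y | p ≟ N y
  ... | yes e | _     | _     = at-x e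
  ... | no a  | yes e | _     = at-y a e
  ... | no a  | no b  | yes e = freed a b e
  ... | no a  | no b  | no c  = other a b c

  link-fixes : ∀ {p} → p ≢ x → p ≢ y → N p ≡ p → N′ p ≡ p
  link-fixes {p} a b Np≡p with view p
  ... | at-x e      = contradiction e a
  ... | at-y _ e    = contradiction e b
  ... | freed _ _ e = link-freed a b e
  ... | other _ _ c = trans (link-other a b c) Np≡p

  link-involutive : Involutive N′
  link-involutive p with view p
  ... | at-x refl = trans (cong N′ link-x) link-y
  ... | at-y _ refl = trans (cong N′ link-y) link-x
  ... | freed a b e = trans (cong N′ (link-freed a b e)) (link-freed a b e)
  ... | other a b c = trans (cong N′ (link-other a b c)) (trans (link-other a′ b′ c′) (inv p))
    where
    a′ : N p ≢ x
    a′ e = a (trans (sym (inv p)) (trans (cong N e) Nx≡x))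
    b′ : N p ≢ y
    b′ e = c (trans (sym (inv p)) (cong N e))
    c′ : N p ≢ N y
    c′ e = b (trans (sym (inv p)) (trans (cong N e) (inv y)))

  -- The fixed point `x` is lost and none is gained, since `N y` is `y` itself.
  link-#fixed-< : N y ≡ y → #fixed N′ < #fixed N
  link-#fixed-< Ny≡y = subst (_≤ #fixed N) eq (sum-mono below)
    where
    below : ∀ p → δ x p + fixed N′ p ≤ fixed N p
    below p with view p
    ... | at-x refl rewrite link-x | Nx≡x | δ-≢ y≢x | δ-refl x = ≤-refl
    ... | at-y _ refl rewrite link-y | Ny≡y | δ-refl y | δ-≢ (y≢x ∘ sym) = z≤n
    ... | freed a b e = contradiction (trans e Ny≡y) b
    ... | other a b c rewrite link-other a b c | δ-≢ (a ∘ sym) = ≤-refl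
    eq : sum (λ p → δ x p + fixed N′ p) ≡ suc (#fixed N′)
    eq = trans (∑-distrib-+ (δ x) (fixed N′)) (cong (_+ #fixed N′) (sum-δ x))

  -- Only `N y` can become fixed, and the loss of `x` compensates for it; hence the extra `δ (N y)`
  -- on the larger side.
  link-#fixed-≤ : #fixed N′ ≤ #fixed N
  link-#fixed-≤ = +-cancelˡ-≤ 1 _ _ (subst₂ _≤_ eqˡ eqʳ (sum-mono below))
    where
    below : ∀ p → δ x p + fixed N′ p ≤ δ (N y) p + fixed N p
    below p with view p
    ... | at-x refl rewrite link-x | Nx≡x | δ-≢ y≢x | δ-refl x = m≤n+m 1 _
    ... | at-y _ refl rewrite link-y | δ-≢ (y≢x ∘ sym) = z≤n
    ... | freed a b refl rewrite δ-≢ (a ∘ sym) | δ-refl (N y) =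
        ≤-trans (⟦⟧≤1 (does (N′ (N y) ≟ N y))) (m≤m+n 1 _)
    ... | other a b c rewrite link-other a b c | δ-≢ (a ∘ sym) = m≤n+m _ _
    eqˡ : sum (λ p → δ x p + fixed N′ p) ≡ 1 + #fixed N′
    eqˡ = trans (∑-distrib-+ (δ x) (fixed N′)) (cong (_+ #fixed N′) (sum-δ x))
    eqʳ : sum (λ p → δ (N y) p + fixed N p) ≡ 1 + #fixed N
    eqʳ = trans (∑-distrib-+ (δ (N y)) (fixed N)) (cong (_+ #fixed N) (sum-δ (N y)))

-- Perfect matchings in graphs with large odd cuts

-- A matching is an involution whose non-fixed points are joined to their images; the fixed
-- points are the vertices it misses.
record Matching {n} (R : Fin n → Fin n → Set) (σ : Fin n → Fin n) : Set where
  constructor matching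
  field
    involutive : Involutive σ
    along      : ∀ p → σ p ≡ p ⊎ R p (σ p)
open Matching

link-matching : ∀ {n} {R : Fin n → Fin n → Set} → (∀ {i j} → R i j → R j i) →
  ∀ {N x y} → Matching R N → N x ≡ x → y ≢ x → R x y → Matching R (link N x y)
link-matching {R = R} R-sym {N} {x} {y} m Nx≡x y≢x Rxy = matching link-involutive along′
  where
  open Link {N = N} (involutive m) Nx≡x y≢x
  along′ : ∀ p → N′ p ≡ p ⊎ R p (N′ p)
  along′ p with view p
  ... | at-x refl   = inj₂ (subst (R x) (sym link-x) Rxy)
  ... | at-y _ refl = inj₂ (subst (R y) (sym link-y) (R-sym Rxy))
  ... | freed a b e = inj₁ (link-freed a b e)
  ... | other a b c rewrite link-other a b c = along m p

-- Gallai's lemma on the vertices missed by maximum matchings.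

module Gallai {n : ℕ} (R : Fin n → Fin n → Set) (R-sym : ∀ {i j} → R i j → R j i)
              (d : ℕ) (minimal : ∀ {σ} → Matching R σ → d ≤ #fixed σ) where

  -- An upper bound suffices, as `minimal` gives the opposite inequality.
  record Maximum (σ : Fin n → Fin n) : Set where
    constructor maximum
    field
      isMatching : Matching R σ
      deficiency : #fixed σ ≤ d
  open Maximum

  -- Concluding `u ≡ v` instead of a contradiction makes the relation reflexive.
  _~_ : Fin n → Fin n → Set
  u ~ v = ∀ {M} → Maximum M → M u ≡ u → M v ≡ v → u ≡ v

  ~-sym : ∀ {u v} → u ~ v → v ~ u
  ~-sym u~v max Mv Mu = sym (u~v max Mu Mv)

  -- A maximum matching missing two distinct adjacent vertices could link them, and would then miss
  -- fewer than `d`.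
  adjacent⇒~ : ∀ {u v} → R u v → u ~ v
  adjacent⇒~ {u} {v} Ruv {M} max Mu Mv with v ≟ u
  ... | yes v≡u = sym v≡u
  ... | no  v≢u = contradiction
    (≤-trans (link-#fixed-< Mv) (≤-trans (deficiency max) (minimal (link-matching R-sym (isMatching max) Mu v≢u Ruv))))
    (<-irrefl refl)
    where open Link {N = M} (involutive (isMatching max)) Mu v≢u

  module _ {M : Fin n → Fin n} {u v t : Fin n} (maxM : Maximum M) (Mu : M u ≡ u) (Mv : M v ≡ v) (u≢v : u ≢ v) where

    -- Its sum is the potential that each step of `exchange` increases.
    agree : (Fin n → Fin n) → Fin n → ℕ
    agree N p = δ (M p) (N p)

    -- M and N miss equally many vertices, but N covers both u and v.
    another-missed : ∀ {N} → Maximum N → N u ≢ u → N v ≢ v →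
                     ∃[ x ] x ≢ t × N x ≡ x × M x ≢ x
    another-missed {N} maxN Nu Nv
      with any? (λ x → ¬? (x ≟ t) ×-dec (N x ≟ x ×-dec ¬? (M x ≟ x)))
    ... | yes found = found
    ... | no  none  = contradiction
      (≤-trans (+-monoʳ-≤ 2 (≤-trans (deficiency maxM) (minimal (isMatching maxN))))
        (subst₂ _≤_ eqˡ eqʳ (sum-mono below)))
      (<-irrefl refl)
      where
      -- If there is no such `x`, every point missed by `N` is missed by `M` or is `t`. The unit for
      -- `t` on the right is outweighed by the two for `u` and `v` on the left.
      below : ∀ p → δ u p + (δ v p + fixed N p) ≤ δ t p + fixed M p
      below p with u ≟ p | v ≟ p | N p ≟ p | t ≟ p | M p ≟ p
      ... | yes e | yes f | _     | _     | _     = contradiction (trans e (sym f)) u≢v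
      ... | yes refl | no _ | yes g | _   | _     = contradiction g Nu
      ... | yes e | no _  | no _  | _     | yes _ = m≤n+m 1 _
      ... | yes refl | no _ | no _ | _    | no h  = contradiction Mu h
      ... | no _  | yes refl | yes g | _  | _     = contradiction g Nv
      ... | no _  | yes e | no _  | _     | yes _ = m≤n+m 1 _
      ... | no _  | yes refl | no _ | _   | no h  = contradiction Mv h
      ... | no _  | no _  | no _  | _     | _     = z≤n
      ... | no _  | no _  | yes _ | yes _ | _     = m≤m+n 1 _
      ... | no _  | no _  | yes _ | no _  | yes _ = ≤-refl
      ... | no _  | no _  | yes g | no h  | no k  = contradiction (p , (h ∘ sym) , g , k) none
      eqˡ : sum (λ p → δ u p + (δ v p + fixed N p)) ≡ 2 + #fixed N
      eqˡ = trans (∑-distrib-+ (δ u) _) (cong₂ _+_ (sum-δ u)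
              (trans (∑-distrib-+ (δ v) (fixed N)) (cong (_+ #fixed N) (sum-δ v))))
      eqʳ : sum (λ p → δ t p + fixed M p) ≡ 1 + #fixed M
      eqʳ = trans (∑-distrib-+ (δ t) (fixed M)) (cong (_+ #fixed M) (sum-δ t))

    -- N is moved towards M one edge of M at a time.
    exchange : ∀ k {N} → n < sum (agree N) + k → Maximum N → N t ≡ t →
               ∃[ L ] Maximum L × L t ≡ t × (L u ≡ u ⊎ L v ≡ v)
    -- There are at most `n` agreements, so the fuel cannot run out.
    exchange zero {N} bound maxN Nt = contradiction
      (≤-trans bound (≤-trans (≤-reflexive (+-identityʳ _))
        (≤-trans (sum-mono λ p → ⟦⟧≤1 (does (M p ≟ N p)))
          (≤-reflexive (trans (sum-const n 1) (*-identityʳ n))))))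
      (<-irrefl refl)
    exchange (suc k) {N} bound maxN Nt with N u ≟ u | N v ≟ v
    ... | yes Nu | _      = N , maxN , Nt , inj₁ Nu
    ... | no _   | yes Nv = N , maxN , Nt , inj₂ Nv
    ... | no Nu≢ | no Nv≢ with another-missed maxN Nu≢ Nv≢
    ...   | x , x≢t , Nx , Mx≢x with along (isMatching maxM) x
    ...     | inj₁ Mx = contradiction Mx Mx≢x
    ...     | inj₂ RxMx = exchange k bound′ maxN′ (link-fixes (x≢t ∘ sym) t≢y Nt)
      where
      y : Fin n
      y = M x
      matchN : Matching R N
      matchN = isMatching maxN
      open Link {N = N} (involutive matchN) Nx Mx≢x
      matchN′ : Matching R N′
      matchN′ = link-matching R-sym matchN Nx Mx≢x RxMx
      -- If `N` also missed `y`, adding the edge from `x` to `y` would beat a maximum matching. So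
      -- `t` is not `y` and stays missed after the exchange.
      Ny≢y : N y ≢ y
      Ny≢y Ny = <-irrefl refl (≤-trans (link-#fixed-< Ny) (≤-trans (deficiency maxN) (minimal matchN′)))
      t≢y : t ≢ y
      t≢y refl = Ny≢y Nt
      maxN′ : Maximum N′
      maxN′ = maximum matchN′ (≤-trans link-#fixed-≤ (deficiency maxN))
      MM : Involutive M
      MM = involutive (isMatching maxM)
      -- The agreement at `x` is new. The other points that change are `y` and `N y`, where `M` and
      -- `N` disagreed: `M` pairs `y` with `x`, which `N` misses.
      below : ∀ p → δ x p + agree N p ≤ agree N′ p
      below p with view p
      ... | at-x refl rewrite link-x | Nx | δ-≢ Mx≢x | δ-refl x | δ-refl y = ≤-refl
      ... | at-y _ refl rewrite δ-≢ (Mx≢x ∘ sym) | MM x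
            | δ-≢ {i = x} {j = N y} (λ e → Mx≢x (trans (sym (involutive matchN y)) (trans (cong N (sym e)) Nx))) = z≤n
      ... | freed a b refl rewrite δ-≢ (a ∘ sym) | involutive matchN y
            | δ-≢ {i = M (N y)} {j = y} (λ e → a (trans (sym (MM (N y))) (trans (cong M e) (MM x)))) = z≤n
      ... | other a b c rewrite link-other a b c | δ-≢ (a ∘ sym) = ≤-refl
      bound′ : n < sum (agree N′) + k
      bound′ = ≤-trans bound (≤-trans (≤-reflexive (+-suc _ k)) (+-monoˡ-≤ k
        (subst (_≤ sum (agree N′)) (trans (∑-distrib-+ (δ x) (agree N)) (cong (_+ sum (agree N)) (sum-δ x)))
          (sum-mono below))))

  -- If `M` missed distinct `u` and `v`, moving `N` towards `M` would give a maximum matching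
  -- missing `t` and one of them. The relation to `t` identifies that one with `t`, and then the
  -- other relation applies to `M` itself.
  ~-trans : ∀ {u t v} → (∃[ N ] Maximum N × N t ≡ t) → u ~ t → t ~ v → u ~ v
  ~-trans {u} {t} {v} (N , maxN , Nt) u~t t~v maxM Mu Mv with u ≟ v
  ... | yes u≡v = u≡v
  ... | no u≢v with exchange maxM Mu Mv u≢v (suc n) (m≤n+m (suc n) _) maxN Nt
  ...   | L , maxL , Lt , inj₁ Lu with u~t maxL Lu Lt
  ...     | refl = t~v maxM Mu Mv
  ~-trans {u} {t} {v} (N , maxN , Nt) u~t t~v maxM Mu Mv
      | no u≢v | L , maxL , Lt , inj₂ Lv with t~v maxL Lt Lv
  ...     | refl = u~t maxM Mu Mv

any-vec? : ∀ {n k} {P : Vec (Fin n) k → Set} → (∀ v → Dec (P v)) → Dec (∃ P)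
any-vec? {k = zero}  P? = map′ ([] ,_) (λ { ([] , p) → p }) (P? [])
any-vec? {k = suc k} P? = map′ (λ { (x , v , p) → x ∷ v , p }) (λ { (x ∷ v , p) → x , v , p })
                               (any? λ x → any-vec? λ v → P? (x ∷ v))

PerfectMatching : ∀ {n} → (Fin n → Fin n → ℕ) → (Fin n → Fin n) → Set
PerfectMatching w σ = ∀ p → σ (σ p) ≡ p × σ p ≢ p × 0 < w p (σ p)

-- The existence argument is classical, but the candidates are finitely many: searching all vectors
-- of images turns its double negation into a witness.
perfectMatching-stable : ∀ {n} (w : Fin n → Fin n → ℕ) →
                         ¬ ¬ ∃ (PerfectMatching w) → ∃ (PerfectMatching w)
perfectMatching-stable {n} w ¬¬pm with any-vec? {n} {n} {P = λ v → PerfectMatching w (lookup v)}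
  (λ v → all? λ p → (lookup v (lookup v p) ≟ p) ×-dec (¬? (lookup v p ≟ p) ×-dec (0 <? w p (lookup v p))))
... | yes (v , pm) = lookup v , pm
... | no none = contradiction (λ { (σ , pm) → none (tabulate σ , transfer σ pm) }) ¬¬pm
  where
  transfer : ∀ σ → PerfectMatching w σ → PerfectMatching w (lookup (tabulate σ))
  transfer σ pm p rewrite lookup∘tabulate σ p | lookup∘tabulate σ (σ p) = pm p

∣_∣ᵇ : ∀ {n} → (Fin n → Bool) → ℕ
∣ K ∣ᵇ = sum (λ i → ⟦ K i ⟧)

cut : ∀ {n} → (Fin n → Fin n → ℕ) → (Fin n → Bool) → ℕ
cut w K = sum λ a → ⟦ K a ⟧ * sum λ b → ⟦ not (K b) ⟧ * w a b

id-#fixed : ∀ {n} → #fixed {n} id ≡ n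
id-#fixed {n} = trans (sum-cong-≗ {n} δ-refl) (trans (sum-const n 1) (*-identityʳ n))

even-gap : ∀ {a b} → parity a ≡ parity b → a < b → suc a < b
even-gap {a} {suc b} a≡b (s≤s a≤b) with m≤n⇒m<n∨m≡n a≤b
... | inj₁ a<b  = s≤s a<b
... | inj₂ refl = contradiction (trans a≡b (+-homo-+ 1 a)) (p≢p⁻¹ (parity a))

-- Barriers and the classes of a maximal one.

module OddCuts {n : ℕ} (w : Fin n → Fin n → ℕ) (w-sym : ∀ a b → w a b ≡ w b a)
  (r : ℕ) (0<r : 0 < r) (row : ∀ a → sum (w a) ≡ r)
  (odd-cut : ∀ K → parity ∣ K ∣ᵇ ≡ 1ℙ → r ≤ cut w K) where

  -- Otherwise the set of all vertices would be odd with an empty cut.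
  n-even : parity n ≡ 0ℙ
  n-even with parity n in eq
  ... | 0ℙ = refl
  ... | 1ℙ = contradiction
    (≤-trans 0<r (≤-trans (odd-cut (λ _ → true) (trans (cong parity (trans (sum-const n 1) (*-identityʳ n))) eq))
      (≤-reflexive (sum-zero {n} λ a → trans (*-identityˡ _) (sum-zero {n} {λ b → 0 * w a b} λ _ → refl)))))
    (<-irrefl refl)

  #fixed-even : ∀ {σ} → Involutive σ → parity (#fixed σ) ≡ 0ℙ
  #fixed-even {σ} inv = begin
    parity (#fixed σ)                      ≡⟨ cong parity (sum-cong-≗ {n} λ i → sym (*-identityˡ (fixed σ i))) ⟩
    parity (sum (λ i → 1 * fixed σ i))     ≡⟨ invariant-parity {n} {σ} inv (λ _ → 1) (λ _ → refl) ⟨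
    parity (sum {n} (λ _ → 1))             ≡⟨ cong parity (trans (sum-const n 1) (*-identityʳ n)) ⟩
    parity n                               ≡⟨ n-even ⟩
    0ℙ                                     ∎
    where open ≡-Reasoning

  Residual : (Fin n → Bool) → Fin n → Fin n → Set
  Residual U a b = U a ≡ false × U b ≡ false × 0 < w a b

  Residual-sym : ∀ {U a b} → Residual U a b → Residual U b a
  Residual-sym {a = a} {b} (Ua , Ub , w>0) = Ub , Ua , subst (0 <_) (w-sym a b) w>0

  -- The vertices of U are themselves fixed, so more than |U| vertices outside U are missed.
  Barrier : (Fin n → Bool) → Set
  Barrier U = ∀ {σ} → Matching (Residual U) σ → ∣ U ∣ᵇ + ∣ U ∣ᵇ < #fixed σ

  id-matching : ∀ {R : Fin n → Fin n → Set} → Matching R id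
  id-matching = matching (λ _ → refl) (λ _ → inj₁ refl)

  barrier<n : ∀ {U} → Barrier U → ∣ U ∣ᵇ < n
  barrier<n {U} barrier = ≤-<-trans (m≤m+n ∣ U ∣ᵇ _)
    (≤-trans (barrier id-matching) (≤-reflexive id-#fixed))

  module MaximalBarrier (U : Fin n → Bool) (barrier : Barrier U) where

    d : ℕ
    d = 2 + (∣ U ∣ᵇ + ∣ U ∣ᵇ)

    -- The number of fixed points is even, like twice the size of `U`, so exceeding the latter means
    -- exceeding it by two.
    minimal : ∀ {σ} → Matching (Residual U) σ → d ≤ #fixed σ
    minimal {σ} m = even-gap
      (trans (trans (+-homo-+ ∣ U ∣ᵇ _) (p+p≡0ℙ (parity ∣ U ∣ᵇ))) (sym (#fixed-even {σ} (involutive m))))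
      (barrier m)

    open Gallai (Residual U) (Residual-sym {U}) d minimal public
    open Maximum

    -- `missable` makes `_~_` transitive through vertices outside `U`. One maximum matching `M` is
    -- fixed, and only the classes of vertices outside `U` that it misses are counted.
    impossible : (∀ v → U v ≡ false → ∃[ N ] Maximum N × N v ≡ v) →
                 (∀ u v → Dec (u ~ v)) → ⊥
    impossible missable ~? with any? (λ v → U v Data.Bool.≟ false)
    ... | no full = <-irrefl refl (≤-trans (barrier<n barrier)
          (≤-trans (≤-reflexive (trans (sym (*-identityʳ n)) (sym (sum-const n 1)))) (sum-mono inU)))
      where
      inU : ∀ v → 1 ≤ ⟦ U v ⟧
      inU v with U v in eq
      ... | true  = ≤-refl
      ... | false = contradiction (v , eq) full
    ... | yes (v₀ , Uv₀) with missable v₀ Uv₀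
    ...   | M , maxM , _ = <-irrefl refl (≤-trans (n≤1+n _)
              (*-cancelʳ-≤ (2 + ∣ U ∣ᵇ) ∣ U ∣ᵇ r {{>-nonZero 0<r}} (≤-trans (*-monoˡ-≤ r many) charge)))
      where
      class : Fin n → Fin n → Bool
      class f a = not (U a) ∧ does (~? f a)

      rep : Fin n → Bool
      rep f = not (U f) ∧ does (M f ≟ f)

      class-in : ∀ {f a} → U a ≡ false → f ~ a → class f a ≡ true
      class-in {f} {a} Ua f~a rewrite Ua = dec-true (~? f a) f~a

      class-out : ∀ {f a} → class f a ≡ true → U a ≡ false × f ~ a
      class-out {f} {a} eq with U a | ~? f a
      class-out refl | false | yes f~a = refl , f~a

      rep-out : ∀ {f} → rep f ≡ true → U f ≡ false × M f ≡ f
      rep-out {f} eq with U f | M f ≟ f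
      rep-out refl | false | yes Mf = refl , Mf

      -- Of the points missed by `M`, at least `d` in number, no more than the size of `U` lie in
      -- `U`.
      many : 2 + ∣ U ∣ᵇ ≤ ∣ rep ∣ᵇ
      many = +-cancelˡ-≤ ∣ U ∣ᵇ _ _ (≤-trans (≤-reflexive (lem ∣ U ∣ᵇ))
        (≤-trans (minimal (isMatching maxM)) (subst (#fixed M ≤_) (∑-distrib-+ (λ i → ⟦ U i ⟧) (λ i → ⟦ rep i ⟧)) (sum-mono below))))
        where
        lem : ∀ x → x + (2 + x) ≡ 2 + (x + x)
        lem = solve-∀
        below : ∀ p → fixed M p ≤ ⟦ U p ⟧ + ⟦ rep p ⟧
        below p with U p
        ... | true  = ≤-trans (⟦⟧≤1 (does (M p ≟ p))) (m≤m+n 1 0)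
        ... | false = ≤-refl

      class-closed : ∀ {f a} → (N : Fin n → Fin n) → Maximum N → class f a ≡ true → class f (N a) ≡ true
      class-closed {f} {a} N maxN in-class with class-out {f} {a} in-class | along (isMatching maxN) a
      ... | _        | inj₁ Na = trans (cong (class f) Na) in-class
      ... | Ua , f~a | inj₂ RaNa@(_ , UNa , _) =
        class-in {f} UNa (~-trans (missable a Ua) f~a (adjacent⇒~ RaNa))

      class-invariant : ∀ {f} N → Maximum N → ∀ a → class f (N a) ≡ class f a
      class-invariant {f} N maxN a with class f a in eq | class f (N a) in eq′
      ... | true  | true  = refl
      ... | false | false = refl
      ... | true  | false = trans (sym eq′) (class-closed {f} N maxN eq)
      ... | false | true  = trans (sym (class-closed {f} N maxN eq′))
        (trans (cong (class f) (involutive (isMatching maxN) a)) eq)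

      -- `M` maps the class to itself and fixes only `f` in it, because two equivalent vertices
      -- missed by `M` coincide.
      class-odd : ∀ {f} → rep f ≡ true → parity ∣ class f ∣ᵇ ≡ 1ℙ
      class-odd {f} rf = trans
        (invariant-parity {σ = M} (involutive (isMatching maxM)) (λ a → ⟦ class f a ⟧) (λ a → cong ⟦_⟧ (class-invariant {f} M maxM a)))
        (cong parity (trans (sum-cong-≗ only) (sum-δ f)))
        where
        Uf = proj₁ (rep-out rf)
        Mf = proj₂ (rep-out rf)
        only : ∀ a → ⟦ class f a ⟧ * fixed M a ≡ δ f a
        only a with f ≟ a
        ... | yes refl rewrite class-in {f} {f} Uf (λ _ _ _ → refl) | Mf | δ-refl f = refl
        ... | no f≢a with class f a in eq | M a ≟ a
        ...   | false | _      = refl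
        ...   | true  | no _   = refl
        ...   | true  | yes Ma = contradiction (proj₂ (class-out {f} {a} eq) maxM Mf Ma) f≢a

      toU : Fin n → ℕ
      toU a = sum λ b → ⟦ U b ⟧ * w a b

      -- An edge from the class to a vertex outside `U` joins equivalent vertices, so everything in
      -- the cut ends in `U`.
      class-cut : ∀ {f} → rep f ≡ true → r ≤ sum (λ a → ⟦ class f a ⟧ * toU a)
      class-cut {f} rf = ≤-trans (odd-cut (class f) (class-odd rf)) (sum-mono below)
        where
        below : ∀ a → ⟦ class f a ⟧ * sum (λ b → ⟦ not (class f b) ⟧ * w a b) ≤ ⟦ class f a ⟧ * toU a
        below a with class f a in eq
        ... | false = z≤n
        ... | true  = +-monoˡ-≤ 0 (sum-mono inner)
          where
          Ua  = proj₁ (class-out {f} {a} eq)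
          f~a = proj₂ (class-out {f} {a} eq)
          inner : ∀ b → ⟦ not (class f b) ⟧ * w a b ≤ ⟦ U b ⟧ * w a b
          inner b with U b in Ub | w a b in wab
          ... | true | k  = *-monoˡ-≤ k (⟦⟧≤1 (not (false ∧ does (~? f b))))
          ... | false | zero = ≤-reflexive (*-zeroʳ ⟦ not (does (~? f b)) ⟧)
          ... | false | suc k
            rewrite dec-true (~? f b) (~-trans (missable a Ua) f~a (adjacent⇒~ (Ua , Ub , subst (0 <_) (sym wab) (s≤s z≤n))))
            = z≤n

      -- Two representatives equivalent to `a` are equivalent to each other and both missed by `M`,
      -- hence equal.
      one-rep : ∀ a → sum (λ f → ⟦ rep f ⟧ * ⟦ class f a ⟧) ≤ 1
      one-rep a = ≤-trans (≤-reflexive (sum-cong-≗ λ f → conj (rep f) (class f a)))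
                          (count-unique (λ f → rep f ∧ class f a) unique)
        where
        conj : ∀ x y → ⟦ x ⟧ * ⟦ y ⟧ ≡ ⟦ x ∧ y ⟧
        conj false y     = refl
        conj true  false = refl
        conj true  true  = refl
        split : ∀ x y → x ∧ y ≡ true → x ≡ true × y ≡ true
        split true true _ = refl , refl
        unique : ∀ f g → rep f ∧ class f a ≡ true → rep g ∧ class g a ≡ true → f ≡ g
        unique f g pf pg with split (rep f) _ pf | split (rep g) _ pg
        ... | rf , cf | rg , cg with class-out {f} {a} cf | class-out {g} {a} cg
        ...   | Ua , f~a | _ , g~a =
          ~-trans (missable a Ua) f~a (~-sym g~a) maxM (proj₂ (rep-out rf)) (proj₂ (rep-out rg))

      -- Double counting of the edges between the classes and `U`: each class sends at least `r`,
      -- and each vertex of `U` receives at most `r`.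
      charge : ∣ rep ∣ᵇ * r ≤ ∣ U ∣ᵇ * r
      charge = begin
        ∣ rep ∣ᵇ * r
          ≡⟨ *-distribʳ-sum r (λ f → ⟦ rep f ⟧) ⟩
        sum (λ f → ⟦ rep f ⟧ * r)
          ≤⟨ sum-mono each ⟩
        sum (λ f → ⟦ rep f ⟧ * sum (λ a → ⟦ class f a ⟧ * toU a))
          ≡⟨ sum-cong-≗ (λ f → trans (*-distribˡ-sum ⟦ rep f ⟧ (λ a → ⟦ class f a ⟧ * toU a))
               (sum-cong-≗ λ a → sym (*-assoc ⟦ rep f ⟧ ⟦ class f a ⟧ (toU a)))) ⟩
        sum (λ f → sum λ a → ⟦ rep f ⟧ * ⟦ class f a ⟧ * toU a)
          ≡⟨ ∑-comm (λ f a → ⟦ rep f ⟧ * ⟦ class f a ⟧ * toU a) ⟩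
        sum (λ a → sum λ f → ⟦ rep f ⟧ * ⟦ class f a ⟧ * toU a)
          ≡⟨ sum-cong-≗ (λ a → sym (*-distribʳ-sum (toU a) (λ f → ⟦ rep f ⟧ * ⟦ class f a ⟧))) ⟩
        sum (λ a → sum (λ f → ⟦ rep f ⟧ * ⟦ class f a ⟧) * toU a)
          ≤⟨ sum-mono (λ a → ≤-trans (*-monoˡ-≤ (toU a) (one-rep a)) (≤-reflexive (*-identityˡ _))) ⟩
        sum (λ a → sum λ b → ⟦ U b ⟧ * w a b)
          ≡⟨ ∑-comm (λ a b → ⟦ U b ⟧ * w a b) ⟩
        sum (λ b → sum λ a → ⟦ U b ⟧ * w a b)
          ≡⟨ sum-cong-≗ (λ b → trans (sym (*-distribˡ-sum ⟦ U b ⟧ (λ a → w a b)))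
               (cong (⟦ U b ⟧ *_) (trans (sum-cong-≗ λ a → w-sym a b) (row b)))) ⟩
        sum (λ b → ⟦ U b ⟧ * r)
          ≡⟨ *-distribʳ-sum r (λ b → ⟦ U b ⟧) ⟨
        ∣ U ∣ᵇ * r ∎
        where
        open ≤-Reasoning
        each : ∀ f → ⟦ rep f ⟧ * r ≤ ⟦ rep f ⟧ * sum (λ a → ⟦ class f a ⟧ * toU a)
        each f with rep f in rf
        ... | false = z≤n
        ... | true  = +-monoˡ-≤ 0 (class-cut rf)

  insert : Fin n → (Fin n → Bool) → Fin n → Bool
  insert v U i = U i ∨ does (v ≟ i)

  ∣insert∣ : ∀ {v U} → U v ≡ false → ∣ insert v U ∣ᵇ ≡ suc ∣ U ∣ᵇ
  ∣insert∣ {v} {U} Uv = trans (sum-cong-≗ pointwise)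
    (trans (∑-distrib-+ (δ v) (λ i → ⟦ U i ⟧)) (cong (_+ ∣ U ∣ᵇ) (sum-δ v)))
    where
    pointwise : ∀ i → ⟦ insert v U i ⟧ ≡ δ v i + ⟦ U i ⟧
    pointwise i with v ≟ i
    ... | yes refl rewrite Uv = refl
    ... | no _ with U i
    ...   | true  = refl
    ...   | false = refl

  weaken : ∀ {v U σ} → Matching (Residual (insert v U)) σ → Matching (Residual U) σ
  weaken {v} {U} {σ} m = matching (involutive m) along′
    where
    outside : ∀ i → insert v U i ≡ false → U i ≡ false
    outside i eq with U i
    ... | false = refl
    along′ : ∀ p → σ p ≡ p ⊎ Residual U p (σ p)
    along′ p with along m p
    ... | inj₁ fix = inj₁ fix
    ... | inj₂ (a , b , c) = inj₂ (outside p a , outside (σ p) b , c)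

  misses-inserted : ∀ {v U σ} → Matching (Residual (insert v U)) σ → σ v ≡ v
  misses-inserted {v} {U} m with along m v
  ... | inj₁ fix = fix
  ... | inj₂ (out , _) = contradiction (trans (sym in′) out) λ ()
    where
    in′ : insert v U v ≡ true
    in′ rewrite dec-true (v ≟ v) refl with U v
    ... | true  = refl
    ... | false = refl

  -- Induction on the room `k` left for enlarging `U`: a vertex outside `U` that is not missed by
  -- any matching of deficiency `d` could be added to give a larger barrier.
  no-barrier : ∀ k {U} → n ≤ ∣ U ∣ᵇ + k → ¬ Barrier U
  no-barrier zero bound barrier = <-irrefl refl
    (≤-trans (barrier<n barrier) (≤-trans bound (≤-reflexive (+-identityʳ _))))
  -- Missability and the decidability of `_~_` hold only up to double negation; as the goal is
  -- empty, `sequence` can collect them over all vertices.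
  no-barrier (suc k) {U} bound barrier = sequence applicative missable λ missable′ →
    sequence applicative (λ u → sequence applicative λ v → ¬¬-excluded-middle {A = u ~ v})
      (impossible missable′)
    where
    open MaximalBarrier U barrier
    applicative = RawMonad.rawApplicative ¬¬-Monad
    missable : ∀ v → ¬ ¬ (U v ≡ false → ∃[ N ] Maximum N × N v ≡ v)
    missable v no-max = no-barrier k
      (≤-trans bound (≤-reflexive (trans (+-suc ∣ U ∣ᵇ k) (cong (_+ k) (sym (∣insert∣ {v} {U} Uv)))))) barrier′
      where
      Uv : U v ≡ false
      Uv with U v
      ... | false = refl
      ... | true  = contradiction (λ ()) no-max
      barrier′ : Barrier (insert v U)
      -- A matching that avoids `v` and misses too few points for the larger barrier would be a
      -- maximum matching for `U` missing `v`.
      barrier′ {σ} m = ≰⇒> λ few → no-max λ _ → σ , maximum (weaken {v} {U} m)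
        (≤-trans few (≤-reflexive (trans (cong (λ k → k + k) (∣insert∣ {v} {U} Uv)) (cong suc (+-suc ∣ U ∣ᵇ ∣ U ∣ᵇ)))))
        , misses-inserted {v} {U} m

  -- A matching without missed vertices is perfect, so if there were none the empty set would be a
  -- barrier.
  exists-perfectMatching : ∃ (PerfectMatching w)
  exists-perfectMatching = perfectMatching-stable w λ none →
    no-barrier n {λ _ → false} (m≤n+m n _) (empty-barrier none)
    where
    empty-barrier : ¬ ∃ (PerfectMatching w) → Barrier (λ _ → false)
    empty-barrier none {σ} m rewrite sum-zero {n} {λ _ → 0} (λ _ → refl) = ≰⇒> λ few →
      none (σ , λ p → involutive m p , moved few p , edge few p)
      where
      moved : #fixed σ ≤ 0 → ∀ p → σ p ≢ p
      moved few p σp = <-irrefl refl (≤-trans (≤-reflexive (sym (trans (cong ⟦_⟧ (dec-true (σ p ≟ p) σp)) refl)))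
        (≤-trans (term≤sum (fixed σ) p) few))
      edge : #fixed σ ≤ 0 → ∀ p → 0 < w p (σ p)
      edge few p with along m p
      ... | inj₁ σp = contradiction σp (moved few p)
      ... | inj₂ (_ , _ , w>0) = w>0

-- The factor gadget

sum-splitAt : ∀ a {b} (g : Fin a ⊎ Fin b → ℕ) →
              sum (λ i → g (splitAt a i)) ≡ sum (λ i → g (inj₁ i)) + sum (λ j → g (inj₂ j))
sum-splitAt zero    g = refl
sum-splitAt (suc a) g = trans (cong (g (inj₁ zero) +_) (sum-splitAt a (g ∘ Sum.map₁ suc)))
                              (sym (+-assoc (g (inj₁ zero)) _ _))

sum-remQuot : ∀ a b (g : Fin a × Fin b → ℕ) →
              sum (λ i → g (remQuot {a} b i)) ≡ sum (λ i → sum λ j → g (i , j))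
sum-remQuot zero    b g = refl
sum-remQuot (suc a) b g = trans (sum-cong-≗ unfold) (trans (sum-splitAt b g′)
  (cong (sum (λ j → g (zero , j)) +_) (sum-remQuot a b (g ∘ Product.map₁ suc))))
  where
  g′ : Fin b ⊎ Fin (a * b) → ℕ
  g′ (inj₁ j) = g (zero , j)
  g′ (inj₂ i) = g (Product.map₁ suc (remQuot {a} b i))
  unfold : ∀ i → g (remQuot {suc a} b i) ≡ g′ (splitAt b i)
  unfold i with splitAt b i
  ... | inj₁ j = refl
  ... | inj₂ j = refl

decide : ∀ {n} {A B : Fin n → Set} → (∀ i → A i ⊎ B i) → ∃ A ⊎ (∀ i → B i)
decide {zero}  h = inj₂ λ ()
decide {suc n} h with h zero | decide (h ∘ suc)
... | inj₁ a | _             = inj₁ (zero , a)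
... | inj₂ _ | inj₁ (i , a)  = inj₁ (suc i , a)
... | inj₂ b | inj₂ bs       = inj₂ λ { zero → b ; (suc i) → bs i }

-- With the vertex sum taken first, each `δ` selects the weight of its own end. This serves both the
-- cuts of the gadget and the parities of boundaries.
sum-handshake : ∀ {n m} (end : Fin m → Bool → Fin n) (H : Fin n → ℕ) (k : Fin m → Bool → ℕ) →
  sum (λ v → H v * sum λ e → k e false * δ (end e false) v + k e true * δ (end e true) v) ≡
  sum (λ e → k e false * H (end e false) + k e true * H (end e true))
sum-handshake {n} {m} end H k = begin
  sum (λ v → H v * sum (Y v))            ≡⟨ sum-cong-≗ (λ v → *-distribˡ-sum (H v) (Y v)) ⟩
  sum (λ v → sum λ e → H v * Y v e)      ≡⟨ ∑-comm (λ v e → H v * Y v e) ⟩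
  sum (λ e → sum λ v → H v * Y v e)      ≡⟨ sum-cong-≗ edge-sum ⟩
  sum (λ e → k e false * H (end e false) + k e true * H (end e true)) ∎
  where
  open ≡-Reasoning
  Y : Fin n → Fin m → ℕ
  Y v e = k e false * δ (end e false) v + k e true * δ (end e true) v
  side : ∀ e b → sum (λ v → k e b * (δ (end e b) v * H v)) ≡ k e b * H (end e b)
  side e b = trans (sym (*-distribˡ-sum (k e b) (λ v → δ (end e b) v * H v)))
                   (cong (k e b *_) (sum-δ* (end e b) H))
  expand : ∀ h x y p q → h * (x * p + y * q) ≡ x * (p * h) + y * (q * h)
  expand = solve-∀
  edge-sum : ∀ e → sum (λ v → H v * Y v e) ≡ k e false * H (end e false) + k e true * H (end e true)
  edge-sum e = trans
    (sum-cong-≗ λ v → expand (H v) (k e false) (k e true) (δ (end e false) v) (δ (end e true) v))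
    (trans (∑-distrib-+ (λ v → k e false * (δ (end e false) v * H v)) (λ v → k e true * (δ (end e true) v * H v)))
      (cong₂ _+_ (side e false) (side e true)))

module EdgeSet {n m : ℕ} (end : Fin m → Bool → Fin n) where

  degreeIn : (Fin m → Bool) → Fin n → ℕ
  degreeIn S v = sum λ e → ⟦ S e ⟧ * δ (end e false) v + ⟦ S e ⟧ * δ (end e true) v

  boundary : (Fin m → Bool) → (Fin n → Bool) → ℕ
  boundary S X = sum λ e → ⟦ S e ∧ (X (end e false) xor X (end e true)) ⟧

mismatch : Bool → Bool → ℕ
mismatch p q = ⟦ p ⟧ * ⟦ not q ⟧ + ⟦ not p ⟧ * ⟦ q ⟧

-- An edge whose ends lie in gadgets with cores on sides x and y of a cut, and whose ports lie on
-- sides p and q, contributes s times the first and c times the second of these numbers.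
mateMismatch coreMismatch : (a p q x y : Bool) → ℕ
mateMismatch a p q x y = mismatch p q
coreMismatch a p q x y = if a then mismatch p x + mismatch q y else mismatch p q

-- Either the edge alone pays for a whole cut, or its crossing from `x` to `y` goes to one of two
-- accounts: `p₀` if its ports are separated, `p₁` if a port is separated from its cores. The last
-- clause ties the parity of the ports in the cut to `p₀`.
edge-cases : ∀ a p q x y → let u = mateMismatch a p q x y; v = coreMismatch a p q x y in
  (1 ≤ u × 1 ≤ v) ⊎
  ∃₂ λ p₀ p₁ → p₀ + p₁ ≡ ⟦ a ∧ (x xor y) ⟧ × p₀ ≤ u × p₁ ≤ v ×
               parity (⟦ p ⟧ + ⟦ q ⟧) ≡ parity p₀
edge-cases false false false x     y     = inj₂ (0 , 0 , refl , z≤n , z≤n , refl)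
edge-cases false false true  x     y     = inj₁ (≤-refl , ≤-refl)
edge-cases false true  false x     y     = inj₁ (≤-refl , ≤-refl)
edge-cases false true  true  x     y     = inj₂ (0 , 0 , refl , z≤n , z≤n , refl)
edge-cases true  false false false false = inj₂ (0 , 0 , refl , z≤n , z≤n , refl)
edge-cases true  false false false true  = inj₂ (0 , 1 , refl , z≤n , ≤-refl , refl)
edge-cases true  false false true  false = inj₂ (0 , 1 , refl , z≤n , ≤-refl , refl)
edge-cases true  false false true  true  = inj₂ (0 , 0 , refl , z≤n , z≤n , refl)
edge-cases true  false true  false false = inj₁ (≤-refl , ≤-refl)
edge-cases true  false true  false true  = inj₂ (1 , 0 , refl , ≤-refl , z≤n , refl)
edge-cases true  false true  true  false = inj₁ (≤-refl , n≤1+n 1)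
edge-cases true  false true  true  true  = inj₁ (≤-refl , ≤-refl)
edge-cases true  true  false false false = inj₁ (≤-refl , ≤-refl)
edge-cases true  true  false false true  = inj₁ (≤-refl , n≤1+n 1)
edge-cases true  true  false true  false = inj₂ (1 , 0 , refl , ≤-refl , z≤n , refl)
edge-cases true  true  false true  true  = inj₁ (≤-refl , ≤-refl)
edge-cases true  true  true  false false = inj₂ (0 , 0 , refl , z≤n , z≤n , refl)
edge-cases true  true  true  false true  = inj₂ (0 , 1 , refl , z≤n , ≤-refl , refl)
edge-cases true  true  true  true  false = inj₂ (0 , 1 , refl , z≤n , ≤-refl , refl)
edge-cases true  true  true  true  true  = inj₂ (0 , 0 , refl , z≤n , z≤n , refl)

module Gadget {n m : ℕ} (end : Fin m → Bool → Fin n) (act : Fin m → Bool) (s c : ℕ) where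

  open EdgeSet end

  -- Every vertex v becomes c cores (v , i), joined to the ports (e , b) of the edge ends at v; the
  -- two ports of an edge are joined by s parallel edges. A perfect matching leaves exactly
  -- degree − c ports at v to be matched along their edges. Inactive edges have detached ports.
  Node : Set
  Node = (Fin m × Bool) ⊎ (Fin n × Fin c)

  pattern port e b = inj₁ (e , b)
  pattern core v i = inj₂ (v , i)

  ∑ : (Node → ℕ) → ℕ
  ∑ g = sum (λ e → g (port e false) + g (port e true)) + sum (λ v → sum λ i → g (core v i))

  ι : Fin (m * 2 + n * c) ↔ Node
  ι = (((↔-id _ ×-↔ 2↔Bool) ↔-∘ *↔×) ⊎-↔ *↔×) ↔-∘ +↔⊎

  open Inverse ι using (to; from; strictlyInverseˡ; strictlyInverseʳ)

  sum-nodes : ∀ g → sum (g ∘ to) ≡ ∑ g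
  sum-nodes g = trans (sum-splitAt (m * 2) (g ∘ split)) (cong₂ _+_
    (trans (sum-remQuot m 2 (g ∘ split₁)) (sum-cong-≗ λ e → cong (g (port e false) +_) (+-identityʳ _)))
    (sum-remQuot n c (g ∘ inj₂)))
    where
    split₁ : Fin m × Fin 2 → Node
    split₁ (e , b) = port e (Inverse.to 2↔Bool b)
    split : Fin (m * 2) ⊎ Fin (n * c) → Node
    split = Sum.[ (λ i → split₁ (remQuot {m} 2 i)) , (λ i → inj₂ (remQuot {n} c i)) ]

  ∑-cong : ∀ {f g} → (∀ x → f x ≡ g x) → ∑ f ≡ ∑ g
  ∑-cong h = cong₂ _+_ (sum-cong-≗ λ e → cong₂ _+_ (h (port e false)) (h (port e true)))
                       (sum-cong-≗ λ v → sum-cong-≗ λ i → h (core v i))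

  -- The ports of an inactive edge meet no cores, so their common multiplicity must supply the whole
  -- degree `s + c`.
  capacity : Fin m → ℕ
  capacity e = if act e then s else s + c

  w : Node → Node → ℕ
  w (port e b) (port e′ b′) = δ e e′ * (⟦ b xor b′ ⟧ * capacity e)
  w (port e b) (core v i)   = ⟦ act e ⟧ * δ (end e b) v
  w (core v i) (port e b)   = ⟦ act e ⟧ * δ (end e b) v
  w (core v i) (core _ _)   = 0

  w-sym : ∀ x y → w x y ≡ w y x
  w-sym (port e b) (port e′ b′) with e ≟ e′
  ... | yes refl rewrite δ-refl e = cong (λ k → 1 * (⟦ k ⟧ * capacity e)) (xor-comm b b′)
  ... | no e≢e′ rewrite δ-≢ (e≢e′ ∘ sym) = refl
  w-sym (port e b) (core v i) = refl
  w-sym (core v i) (port e b) = refl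
  w-sym (core v i) (core _ _) = refl

  ∑-port : ∀ (g : Node → ℕ) e b → ∑ (λ x → g x * w (port e b) x) ≡
    g (port e (not b)) * capacity e + ⟦ act e ⟧ * sum (λ i → g (core (end e b) i))
  ∑-port g e b = cong₂ _+_ ports cores
    where
    opposite : ∀ b x y k → x * (1 * (⟦ b xor false ⟧ * k)) + y * (1 * (⟦ b xor true ⟧ * k)) ≡
                           (if b then x else y) * k
    opposite false = lem
      where lem : ∀ x y k → x * (1 * (0 * k)) + y * (1 * (1 * k)) ≡ y * k
            lem = solve-∀
    opposite true  = lem
      where lem : ∀ x y k → x * (1 * (1 * k)) + y * (1 * (0 * k)) ≡ x * k
            lem = solve-∀
    pull : ∀ d x y p q → x * (d * p) + y * (d * q) ≡ d * (x * (1 * p) + y * (1 * q))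
    pull = solve-∀
    select : ∀ b → (if b then g (port e false) else g (port e true)) ≡ g (port e (not b))
    select false = refl
    select true  = refl
    ports : sum (λ e′ → g (port e′ false) * w (port e b) (port e′ false) +
                        g (port e′ true) * w (port e b) (port e′ true)) ≡
            g (port e (not b)) * capacity e
    ports = trans
      (sum-cong-≗ λ e′ → pull (δ e e′) (g (port e′ false)) (g (port e′ true)) (⟦ b xor false ⟧ * capacity e) _)
      (trans (sum-δ* e (λ e′ → g (port e′ false) * (1 * (⟦ b xor false ⟧ * capacity e)) +
                               g (port e′ true) * (1 * (⟦ b xor true ⟧ * capacity e))))
        (trans (opposite b (g (port e false)) (g (port e true)) (capacity e))
          (cong (_* capacity e) (select b))))
    swap : ∀ x a d → x * (a * d) ≡ d * (a * x)
    swap = solve-∀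
    cores : sum (λ v → sum λ i → g (core v i) * (⟦ act e ⟧ * δ (end e b) v)) ≡
            ⟦ act e ⟧ * sum (λ i → g (core (end e b) i))
    cores = trans (sum-cong-≗ λ v → trans
        (sum-cong-≗ λ i → swap (g (core v i)) ⟦ act e ⟧ (δ (end e b) v))
        (trans (sym (*-distribˡ-sum (δ (end e b) v) (λ i → ⟦ act e ⟧ * g (core v i))))
          (cong (δ (end e b) v *_) (sym (*-distribˡ-sum ⟦ act e ⟧ (λ i → g (core v i)))))))
      (sum-δ* (end e b) (λ v → ⟦ act e ⟧ * sum (λ i → g (core v i))))

  ∑-core : ∀ (g : Node → ℕ) v i → ∑ (λ x → g x * w (core v i) x) ≡
    sum (λ e → g (port e false) * ⟦ act e ⟧ * δ (end e false) v + g (port e true) * ⟦ act e ⟧ * δ (end e true) v)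
  ∑-core g v i = trans (cong₂ _+_
      (sum-cong-≗ λ e → sym (cong₂ _+_ (*-assoc (g (port e false)) ⟦ act e ⟧ _) (*-assoc (g (port e true)) ⟦ act e ⟧ _)))
      (sum-zero {n} λ v′ → sum-zero {c} λ j → *-zeroʳ (g (core v′ j))))
    (+-identityʳ _)

  row : (∀ v → degreeIn act v ≡ s + c) → ∀ x → ∑ (w x) ≡ s + c
  row regular x = trans (∑-cong λ y → sym (*-identityˡ (w x y))) (row₁ x)
    where
    row₁ : ∀ x → ∑ (λ y → 1 * w x y) ≡ s + c
    row₁ (port e b) = trans (∑-port (λ _ → 1) e b)
      (trans (cong (λ k → 1 * capacity e + ⟦ act e ⟧ * k) (trans (sum-const c 1) (*-identityʳ c))) total)
      where
      total : 1 * capacity e + ⟦ act e ⟧ * c ≡ s + c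
      total with act e
      ... | true  = cong₂ _+_ (*-identityˡ s) (*-identityˡ c)
      ... | false = trans (+-identityʳ _) (*-identityˡ (s + c))
    row₁ (core v i) = trans (∑-core (λ _ → 1) v i)
      (trans (sum-cong-≗ λ e → cong (λ k → k * δ (end e false) v + k * δ (end e true) v) (*-identityˡ ⟦ act e ⟧)) (regular v))

  -- Cuts of the gadget.

  module Cut (K : Node → Bool) where

    nodeCut : ℕ
    nodeCut = ∑ λ x → ⟦ K x ⟧ * ∑ λ y → ⟦ not (K y) ⟧ * w x y

    P : Fin m → Bool → Bool
    P e b = K (port e b)

    coresIn coresOut : Fin n → ℕ
    coresIn  v = sum λ i → ⟦ K (core v i) ⟧
    coresOut v = sum λ i → ⟦ not (K (core v i)) ⟧

    -- Charges each crossing pair of nodes to one port: a port and a core to that port, two ports to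
    -- the one inside `K`.
    cost : Fin m → Bool → ℕ
    cost e b = ⟦ P e b ⟧ * (⟦ not (P e (not b)) ⟧ * capacity e + ⟦ act e ⟧ * coresOut (end e b)) +
               ⟦ not (P e b) ⟧ * ⟦ act e ⟧ * coresIn (end e b)

    nodeCut≡cost : nodeCut ≡ sum (λ e → cost e false + cost e true)
    nodeCut≡cost = begin
      nodeCut
        ≡⟨ cong₂ _+_ (sum-cong-≗ λ e → cong₂ _+_ (from-port e false) (from-port e true)) from-cores ⟩
      sum (λ e → out e false + out e true) + sum (λ e → in′ e false + in′ e true)
        ≡⟨ ∑-distrib-+ (λ e → out e false + out e true) _ ⟨
      sum (λ e → (out e false + out e true) + (in′ e false + in′ e true))
        ≡⟨ sum-cong-≗ (λ e → exchange (out e false) (out e true) (in′ e false) (in′ e true)) ⟩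
      sum (λ e → cost e false + cost e true) ∎
      where
      open ≡-Reasoning
      exchange : ∀ a b c d → (a + b) + (c + d) ≡ (a + c) + (b + d)
      exchange = solve-∀
      out in′ : Fin m → Bool → ℕ
      out e b = ⟦ P e b ⟧ * (⟦ not (P e (not b)) ⟧ * capacity e + ⟦ act e ⟧ * coresOut (end e b))
      in′ e b = ⟦ not (P e b) ⟧ * ⟦ act e ⟧ * coresIn (end e b)
      from-port : ∀ e b → ⟦ K (port e b) ⟧ * ∑ (λ y → ⟦ not (K y) ⟧ * w (port e b) y) ≡ out e b
      from-port e b = cong (⟦ P e b ⟧ *_) (∑-port (λ y → ⟦ not (K y) ⟧) e b)
      Y : Fin n → ℕ
      Y v = sum λ e → ⟦ not (P e false) ⟧ * ⟦ act e ⟧ * δ (end e false) v +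
                      ⟦ not (P e true) ⟧ * ⟦ act e ⟧ * δ (end e true) v
      from-cores : sum (λ v → sum λ i → ⟦ K (core v i) ⟧ * ∑ (λ y → ⟦ not (K y) ⟧ * w (core v i) y)) ≡
                   sum (λ e → in′ e false + in′ e true)
      from-cores = trans
        (sum-cong-≗ λ v → trans
          (sum-cong-≗ λ i → cong (⟦ K (core v i) ⟧ *_) (∑-core (λ y → ⟦ not (K y) ⟧) v i))
          (sym (*-distribʳ-sum (Y v) (λ i → ⟦ K (core v i) ⟧))))
        (sum-handshake end coresIn (λ e b → ⟦ not (P e b) ⟧ * ⟦ act e ⟧))

    -- Every active port at `v` is joined to all cores of `v`, hence to one across the cut, and
    -- there are `s + c` such ports.
    crossed-core : (∀ v → degreeIn act v ≡ s + c) →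
      ∀ v i j → K (core v i) ≡ true → K (core v j) ≡ false → s + c ≤ nodeCut
    crossed-core regular v i j Ki Kj = begin
      s + c                                  ≡⟨ regular v ⟨
      degreeIn act v                         ≤⟨ sum-mono (λ e → +-mono-≤ (below e false) (below e true)) ⟩
      sum (λ e → cost e false + cost e true) ≡⟨ nodeCut≡cost ⟨
      nodeCut                                ∎
      where
      open ≤-Reasoning
      some-in : 1 ≤ coresIn v
      some-in = subst (λ b → ⟦ b ⟧ ≤ coresIn v) Ki (term≤sum (λ k → ⟦ K (core v k) ⟧) i)
      some-out : 1 ≤ coresOut v
      some-out = subst (λ b → ⟦ not b ⟧ ≤ coresOut v) Kj (term≤sum (λ k → ⟦ not (K (core v k)) ⟧) j)
      below : ∀ e b → ⟦ act e ⟧ * δ (end e b) v ≤ cost e b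
      below e b with end e b ≟ v
      ... | no _ = ≤-trans (≤-reflexive (*-zeroʳ ⟦ act e ⟧)) z≤n
      ... | yes refl with P e b
      ...   | true  = ≤-trans (*-monoʳ-≤ ⟦ act e ⟧ some-out)
                (≤-trans (m≤n+m _ (⟦ not (P e (not b)) ⟧ * capacity e))
                  (≤-trans (≤-reflexive (sym (*-identityˡ _))) (m≤m+n _ _)))
      ...   | false = ≤-trans (*-monoʳ-≤ ⟦ act e ⟧ some-in)
                (≤-reflexive (cong (_* coresIn v) (sym (*-identityˡ ⟦ act e ⟧))))

    module Uncrossed (X : Fin n → Bool) (uniform : ∀ v i → K (core v i) ≡ X v) where

      in≡ : ∀ v → coresIn v ≡ c * ⟦ X v ⟧
      in≡ v = trans (sum-cong-≗ λ i → cong ⟦_⟧ (uniform v i)) (sum-const c _)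

      out≡ : ∀ v → coresOut v ≡ c * ⟦ not (X v) ⟧
      out≡ v = trans (sum-cong-≗ λ i → cong (λ b → ⟦ not b ⟧) (uniform v i)) (sum-const c _)

      u v : Fin m → ℕ
      u e = mateMismatch (act e) (P e false) (P e true) (X (end e false)) (X (end e true))
      v e = coreMismatch (act e) (P e false) (P e true) (X (end e false)) (X (end e true))

      cost≡ : ∀ e → cost e false + cost e true ≡ s * u e + c * v e
      cost≡ e rewrite in≡ (end e false) | in≡ (end e true) | out≡ (end e false) | out≡ (end e true) with act e
      ... | true  = active s c ⟦ P e false ⟧ ⟦ not (P e false) ⟧ ⟦ P e true ⟧ ⟦ not (P e true) ⟧
                      ⟦ X (end e false) ⟧ ⟦ not (X (end e false)) ⟧ ⟦ X (end e true) ⟧ ⟦ not (X (end e true)) ⟧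
        where
        active : ∀ s c p p′ q q′ x x′ y y′ →
          (p * (q′ * s + 1 * (c * x′)) + p′ * 1 * (c * x)) + (q * (p′ * s + 1 * (c * y′)) + q′ * 1 * (c * y)) ≡
          s * (p * q′ + p′ * q) + c * ((p * x′ + p′ * x) + (q * y′ + q′ * y))
        active = solve-∀
      -- Here both mismatches are that of the two ports, so together they account for the
      -- multiplicity `s + c`.
      ... | false = inactive s c ⟦ P e false ⟧ ⟦ not (P e false) ⟧ ⟦ P e true ⟧ ⟦ not (P e true) ⟧
                      (c * ⟦ X (end e false) ⟧) (c * ⟦ not (X (end e false)) ⟧) (c * ⟦ X (end e true) ⟧) (c * ⟦ not (X (end e true)) ⟧)
        where
        inactive : ∀ s c p p′ q q′ x x′ y y′ →
          (p * (q′ * (s + c) + 0 * x′) + p′ * 0 * x) + (q * (p′ * (s + c) + 0 * y′) + q′ * 0 * y) ≡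
          s * (p * q′ + p′ * q) + c * (p * q′ + p′ * q)
        inactive = solve-∀

      nodeCut≡ : nodeCut ≡ sum (λ e → s * u e + c * v e)
      nodeCut≡ = trans nodeCut≡cost (sum-cong-≗ cost≡)

      -- Suppose no edge pays alone. As `c` is even, the cores contribute evenly to `K`, so the
      -- total of `p₀` is odd and thus positive. If that of `p₁` is positive too, the cut has size
      -- at least `s + c`; otherwise the boundary of `X` equals the total of `p₀`, is odd, and the
      -- hypothesis applies.
      uncrossed : parity c ≡ 0ℙ →
        (parity (boundary act X) ≡ 1ℙ → s + c ≤ s * boundary act X) →
        parity (∑ λ x → ⟦ K x ⟧) ≡ 1ℙ → s + c ≤ nodeCut
      uncrossed c-even odd-boundary K-odd
        with decide (λ e → edge-cases (act e) (P e false) (P e true) (X (end e false)) (X (end e true)))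
      ... | inj₁ (e , 1≤u , 1≤v) = begin
        s + c                         ≡⟨ cong₂ _+_ (*-identityʳ s) (*-identityʳ c) ⟨
        s * 1 + c * 1                 ≤⟨ +-mono-≤ (*-monoʳ-≤ s 1≤u) (*-monoʳ-≤ c 1≤v) ⟩
        s * u e + c * v e             ≤⟨ term≤sum (λ e → s * u e + c * v e) e ⟩
        sum (λ e → s * u e + c * v e) ≡⟨ nodeCut≡ ⟨
        nodeCut                       ∎
        where open ≤-Reasoning
      ... | inj₂ facts = ≤-trans (bound (sum p₁) refl) (≤-trans sums (≤-reflexive (sym nodeCut≡)))
        where
        p₀ p₁ : Fin m → ℕ
        p₀ e = proj₁ (facts e)
        p₁ e = proj₁ (proj₂ (facts e))
        boundary≡ : sum p₀ + sum p₁ ≡ boundary act X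
        boundary≡ = trans (sym (∑-distrib-+ p₀ p₁)) (sum-cong-≗ λ e → proj₁ (proj₂ (proj₂ (facts e))))
        sums : s * sum p₀ + c * sum p₁ ≤ sum (λ e → s * u e + c * v e)
        sums = begin
          s * sum p₀ + c * sum p₁
            ≡⟨ cong₂ _+_ (*-distribˡ-sum s p₀) (*-distribˡ-sum c p₁) ⟩
          sum (λ e → s * p₀ e) + sum (λ e → c * p₁ e)
            ≡⟨ ∑-distrib-+ (λ e → s * p₀ e) (λ e → c * p₁ e) ⟨
          sum (λ e → s * p₀ e + c * p₁ e)
            ≤⟨ sum-mono (λ e → let _ , _ , _ , p₀≤u , p₁≤v , _ = facts e in
                 +-mono-≤ (*-monoʳ-≤ s p₀≤u) (*-monoʳ-≤ c p₁≤v)) ⟩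
          sum (λ e → s * u e + c * v e) ∎
          where open ≤-Reasoning
        cores-even : parity (sum coresIn) ≡ 0ℙ
        cores-even = begin
          parity (sum coresIn)                 ≡⟨ cong parity (sum-cong-≗ in≡) ⟩
          parity (sum (λ v → c * ⟦ X v ⟧))     ≡⟨ cong parity (*-distribˡ-sum c (λ v → ⟦ X v ⟧)) ⟨
          parity (c * ∣ X ∣ᵇ)                  ≡⟨ *-homo-* c ∣ X ∣ᵇ ⟩
          parity c ℙ.* parity ∣ X ∣ᵇ           ≡⟨ cong (ℙ._* parity ∣ X ∣ᵇ) c-even ⟩
          0ℙ                                   ∎
          where open ≡-Reasoning
        p₀-odd : parity (sum p₀) ≡ 1ℙ
        p₀-odd = begin
          parity (sum p₀)                                     ≡⟨ sum-parity (λ e → proj₂ (proj₂ (proj₂ (proj₂ (proj₂ (facts e)))))) ⟨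
          parity (sum (λ e → ⟦ P e false ⟧ + ⟦ P e true ⟧))   ≡⟨ ℙ-+-identityʳ _ ⟨
          parity (sum (λ e → ⟦ P e false ⟧ + ⟦ P e true ⟧)) ℙ.+ 0ℙ
            ≡⟨ cong (parity (sum (λ e → ⟦ P e false ⟧ + ⟦ P e true ⟧)) ℙ.+_) cores-even ⟨
          parity (sum (λ e → ⟦ P e false ⟧ + ⟦ P e true ⟧)) ℙ.+ parity (sum coresIn)
            ≡⟨ +-homo-+ (sum (λ e → ⟦ P e false ⟧ + ⟦ P e true ⟧)) (sum coresIn) ⟨
          parity (∑ λ x → ⟦ K x ⟧)                            ≡⟨ K-odd ⟩
          1ℙ                                                  ∎
          where open ≡-Reasoning
        odd⇒positive : ∀ {k} → parity k ≡ 1ℙ → 1 ≤ k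
        odd⇒positive {suc k} _ = s≤s z≤n
        bound : ∀ k → sum p₁ ≡ k → s + c ≤ s * sum p₀ + c * sum p₁
        bound zero none = begin
          s + c                   ≤⟨ odd-boundary (trans (cong parity (sym only)) p₀-odd) ⟩
          s * boundary act X      ≡⟨ cong (s *_) only ⟨
          s * sum p₀              ≤⟨ m≤m+n _ _ ⟩
          s * sum p₀ + c * sum p₁ ∎
          where
          open ≤-Reasoning
          only : sum p₀ ≡ boundary act X
          only = trans (sym (trans (cong (sum p₀ +_) none) (+-identityʳ _))) boundary≡
        bound (suc k) some = ≤-trans
          (≤-reflexive (sym (cong₂ _+_ (*-identityʳ s) (*-identityʳ c))))
          (+-mono-≤ (*-monoʳ-≤ s (odd⇒positive p₀-odd))
                    (*-monoʳ-≤ c (≤-trans (s≤s z≤n) (≤-reflexive (sym some)))))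

-- From perfect matchings of the gadget to factors.

module Factor {n m : ℕ} (end : Fin m → Bool → Fin n) (act : Fin m → Bool) (s c′ : ℕ)
  (regular : ∀ v → EdgeSet.degreeIn end act v ≡ s + suc c′)
  (c-even : parity (suc c′) ≡ 0ℙ)
  (odd-boundary : ∀ X → parity (EdgeSet.boundary end act X) ≡ 1ℙ →
                  s + suc c′ ≤ s * EdgeSet.boundary end act X) where

  -- Positive, so that `core v zero` exists and can tell on which side of a cut the gadget of `v`
  -- lies.
  c : ℕ
  c = suc c′

  open EdgeSet end
  open Gadget end act s c
  open Inverse ι using (to; from; strictlyInverseˡ; strictlyInverseʳ)

  node-cut : ∀ K → parity (∑ λ x → ⟦ K x ⟧) ≡ 1ℙ → s + c ≤ Cut.nodeCut K
  node-cut K K-odd with any? (λ v → any? λ i → ¬? (K (core v i) Data.Bool.≟ K (core v zero)))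
  ... | no none = Uncrossed.uncrossed (λ v → K (core v zero)) uniform c-even
                     (odd-boundary λ v → K (core v zero)) K-odd
    where
    open Cut K
    uniform : ∀ v i → K (core v i) ≡ K (core v zero)
    uniform v i with K (core v i) Data.Bool.≟ K (core v zero)
    ... | yes eq = eq
    ... | no neq = contradiction (v , i , neq) none
  ... | yes (v , i , neq) with K (core v i) in Ki | K (core v zero) in K₀
  ...   | true  | false = Cut.crossed-core K regular v i zero Ki K₀
  ...   | false | true  = Cut.crossed-core K regular v zero i K₀ Ki
  ...   | true  | true  = contradiction refl neq
  ...   | false | false = contradiction refl neq

  w′ : Fin (m * 2 + n * c) → Fin (m * 2 + n * c) → ℕ
  w′ i j = w (to i) (to j)

  odd-cut : ∀ K → parity ∣ K ∣ᵇ ≡ 1ℙ → s + c ≤ cut w′ K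
  odd-cut K K-odd = ≤-trans
    (node-cut (K ∘ from) (trans (cong parity (sym size)) K-odd)) (≤-reflexive (sym cut≡))
    where
    open Cut (K ∘ from)
    size : ∣ K ∣ᵇ ≡ ∑ λ x → ⟦ K (from x) ⟧
    size = trans (sum-cong-≗ λ i → cong (⟦_⟧ ∘ K) (sym (strictlyInverseʳ i))) (sum-nodes λ x → ⟦ K (from x) ⟧)
    cut≡ : cut w′ K ≡ nodeCut
    cut≡ = trans
      (sum-cong-≗ λ i → cong₂ _*_ (cong (⟦_⟧ ∘ K) (sym (strictlyInverseʳ i)))
        (trans (sum-cong-≗ λ j → cong (λ k → ⟦ not (K k) ⟧ * w′ i j) (sym (strictlyInverseʳ j)))
          (sum-nodes λ y → ⟦ not (K (from y)) ⟧ * w (to i) y)))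
      (sum-nodes λ x → ⟦ K (from x) ⟧ * ∑ λ y → ⟦ not (K (from y)) ⟧ * w x y)

  open OddCuts w′ (λ i j → w-sym (to i) (to j)) (s + c) (≤-trans (s≤s z≤n) (m≤n+m c s))
    (λ i → trans (sum-nodes (w (to i))) (row regular (to i))) odd-cut using (exists-perfectMatching)

  abstract
    node-matching : ∃[ τ ] (∀ x → τ (τ x) ≡ x) × (∀ x → 0 < w x (τ x)) × (∀ g → ∑ (g ∘ τ) ≡ ∑ g)
    node-matching with exists-perfectMatching
    ... | σ , perfect = τ , τ-involutive , τ-edge , ∑-τ
      where
      τ : Node → Node
      τ x = to (σ (from x))
      τ-involutive : ∀ x → τ (τ x) ≡ x
      τ-involutive x = trans (cong (to ∘ σ) (strictlyInverseʳ (σ (from x))))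
        (trans (cong to (proj₁ (perfect (from x)))) (strictlyInverseˡ x))
      τ-edge : ∀ x → 0 < w x (τ x)
      τ-edge x = subst (λ y → 0 < w y (τ x)) (strictlyInverseˡ x) (proj₂ (proj₂ (perfect (from x))))
      ∑-τ : ∀ g → ∑ (g ∘ τ) ≡ ∑ g
      ∑-τ g = trans (sym (sum-nodes (g ∘ τ)))
        (trans (sum-cong-≗ λ i → cong (g ∘ to ∘ σ) (strictlyInverseʳ i))
          (trans (sym (sum-involution {σ = σ} (proj₁ ∘ perfect) (g ∘ to))) (sum-nodes g)))

  τ : Node → Node
  τ = proj₁ node-matching

  τ-involutive : ∀ x → τ (τ x) ≡ x
  τ-involutive = proj₁ (proj₂ node-matching)

  τ-edge : ∀ x → 0 < w x (τ x)
  τ-edge = proj₁ (proj₂ (proj₂ node-matching))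

  ∑-τ : ∀ g → ∑ (g ∘ τ) ≡ ∑ g
  ∑-τ = proj₂ (proj₂ (proj₂ node-matching))

  isPort : Node → Bool
  isPort (port _ _) = true
  isPort (core _ _) = false

  factor : Fin m → Bool
  factor e = act e ∧ isPort (τ (port e false))

  port-port : ∀ {e b e′ b′} → 0 < w (port e b) (port e′ b′) → e′ ≡ e × b′ ≡ not b
  port-port {e} {b} {e′} {b′} pos with e ≟ e′
  port-port {e} {false} {b′ = true}  pos | yes refl = refl , refl
  port-port {e} {true}  {b′ = false} pos | yes refl = refl , refl

  port-core : ∀ {e b v i} → 0 < w (port e b) (core v i) → act e ≡ true × end e b ≡ v
  port-core {e} {b} {v} pos with act e | end e b ≟ v
  ... | true | yes eq = refl , eq

  -- A port can be joined to no port but its mate, so if one of the two is matched to a port, they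
  -- are matched to each other. Hence `factor` may inspect only one of them.
  paired : ∀ e b → isPort (τ (port e b)) ≡ isPort (τ (port e (not b)))
  paired e b with τ (port e b) in τb | τ-edge (port e b)
  ... | port e′ b′ | pos with port-port {e} {b} {e′} {b′} pos
  ...   | refl , refl = sym (cong isPort (trans (cong τ (sym τb)) (τ-involutive (port e b))))
  paired e b | core v i | _ with τ (port e (not b)) in τb̄ | τ-edge (port e (not b))
  ...   | core _ _   | _ = refl
  ...   | port e′ b′ | pos with port-port {e} {not b} {e′} {b′} pos
  ...     | refl , eq = contradiction
    (trans (sym τb) (trans (cong (λ k → τ (port e k)) (sym (trans eq (not-involutive b))))
      (trans (cong τ (sym τb̄)) (τ-involutive (port e (not b))))))
    λ ()

  isPort-τ : ∀ e b → isPort (τ (port e b)) ≡ isPort (τ (port e false))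
  isPort-τ e false = refl
  isPort-τ e true  = paired e true

  factor⊆act : ∀ e → factor e ≡ true → act e ≡ true
  factor⊆act e eq with act e
  ... | true = refl

  coreAt : Fin n → Node → ℕ
  coreAt v (port _ _) = 0
  coreAt v (core u _) = δ v u

  ∑-coreAt : ∀ v → ∑ (coreAt v) ≡ c
  ∑-coreAt v = trans (cong₂ _+_ (sum-zero {m} {λ _ → 0} λ _ → refl)
    (trans (sum-cong-≗ {n} λ u → trans (sum-const c (δ v u)) (*-comm c (δ v u))) (sum-δ* v (λ _ → c)))) refl

  core-τ : ∀ v u i → coreAt v (τ (core u i)) ≡ 0
  core-τ v u i with τ (core u i) | τ-edge (core u i)
  ... | port _ _ | _ = refl
  ... | core _ _ | ()

  port-τ : ∀ v e b → coreAt v (τ (port e b)) + ⟦ factor e ⟧ * δ (end e b) v ≡ ⟦ act e ⟧ * δ (end e b) v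
  port-τ v e b rewrite sym (isPort-τ e b) with τ (port e b) | τ-edge (port e b)
  ... | port _ _ | _ = cong (λ k → ⟦ k ⟧ * δ (end e b) v) (∧-identityʳ (act e))
  ... | core u i | pos with port-core {e} {b} {u} {i} pos
  ...   | acte , refl rewrite acte with v ≟ end e b
  ...     | yes refl rewrite δ-refl (end e b) = refl
  ...     | no v≢ rewrite δ-≢ (v≢ ∘ sym) = refl

  -- Cores are matched only to ports and `τ` permutes the nodes, so exactly `c` of the `s + c`
  -- active edge ends at `v` are used up by cores; the others belong to the factor.
  factor-degree : ∀ v → degreeIn factor v ≡ s
  factor-degree v = +-cancelʳ-≡ c _ _ (begin
    degreeIn factor v + c            ≡⟨ +-comm _ c ⟩
    c + degreeIn factor v            ≡⟨ cong (_+ degreeIn factor v) (trans (∑-τ (coreAt v)) (∑-coreAt v)) ⟨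
    ∑ (coreAt v ∘ τ) + degreeIn factor v
      ≡⟨ cong (_+ degreeIn factor v) (trans
           (cong (sum ports +_) (sum-zero {n} λ u → sum-zero {c} λ i → core-τ v u i)) (+-identityʳ _)) ⟩
    sum ports + degreeIn factor v
      ≡⟨ ∑-distrib-+ ports _ ⟨
    sum (λ e → ports e + (⟦ factor e ⟧ * δ (end e false) v + ⟦ factor e ⟧ * δ (end e true) v))
      ≡⟨ sum-cong-≗ (λ e → trans
           (exchange (coreAt v (τ (port e false))) _ (⟦ factor e ⟧ * δ (end e false) v) _)
           (cong₂ _+_ (port-τ v e false) (port-τ v e true))) ⟩
    degreeIn act v                   ≡⟨ regular v ⟩
    s + c                            ∎)
    where
    open ≡-Reasoning
    ports : Fin m → ℕ
    ports e = coreAt v (τ (port e false)) + coreAt v (τ (port e true))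
    exchange : ∀ a b x y → (a + b) + (x + y) ≡ (a + x) + (b + y)
    exchange = solve-∀

  abstract
    exists-factor : ∃[ F ] (∀ e → F e ≡ true → act e ≡ true) × (∀ v → degreeIn F v ≡ s)
    exists-factor = factor , factor⊆act , factor-degree

-- From factors to flows

∑ℕ≡sum : ∀ {n} (f : Fin n → ℕ) → ∑ℕ f ≡ sum f
∑ℕ≡sum {zero}  f = refl
∑ℕ≡sum {suc n} f = cong (f zero +_) (∑ℕ≡sum (f ∘ suc))

⊖-+-⊖ : ∀ a b c d → (a ⊖ b) ℤ.+ (c ⊖ d) ≡ (a + c) ⊖ (b + d)
⊖-+-⊖ a b c d = begin
  (a ⊖ b) ℤ.+ (c ⊖ d)
    ≡⟨ cong₂ ℤ._+_ (m-n≡m⊖n a b) (m-n≡m⊖n c d) ⟨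
  (fromℕ a ℤ.+ ℤ.- fromℕ b) ℤ.+ (fromℕ c ℤ.+ ℤ.- fromℕ d)
    ≡⟨ exchange (fromℕ a) (fromℕ b) (fromℕ c) (fromℕ d) ⟩
  (fromℕ a ℤ.+ fromℕ c) ℤ.+ ℤ.- (fromℕ b ℤ.+ fromℕ d)
    ≡⟨ m-n≡m⊖n (a + c) (b + d) ⟩
  (a + c) ⊖ (b + d) ∎
  where
  open ≡-Reasoning
  exchange : ∀ a b c d → (a ℤ.+ ℤ.- b) ℤ.+ (c ℤ.+ ℤ.- d) ≡ (a ℤ.+ c) ℤ.+ ℤ.- (b ℤ.+ d)
  exchange = ℤRing.solve-∀

∑ℤ-⊖ : ∀ {n} {h : Fin n → ℤ} (f g : Fin n → ℕ) → (∀ i → h i ≡ f i ⊖ g i) → ∑ℤ h ≡ sum f ⊖ sum g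
∑ℤ-⊖ {zero}  f g eq = refl
∑ℤ-⊖ {suc n} f g eq = trans (cong₂ ℤ._+_ (eq zero) (∑ℤ-⊖ (f ∘ suc) (g ∘ suc) (eq ∘ suc)))
                            (⊖-+-⊖ (f zero) (g zero) _ _)

module _ {n m : ℕ} (end : Fin m → Bool → Fin n) where

  open EdgeSet end

  -- Modulo 2, an edge of `S` crosses `X` as often as it has ends in `X`, and these ends number `d`
  -- times the size of `X`.
  even-regular-boundary : ∀ {S d} → (∀ v → degreeIn S v ≡ d) → parity d ≡ 0ℙ →
                          ∀ X → parity (boundary S X) ≡ 0ℙ
  even-regular-boundary {S} {d} regular d-even X = begin
    parity (boundary S X)
      ≡⟨ sum-parity (λ e → crossing (S e) (X (end e false)) (X (end e true))) ⟩
    parity (sum (λ e → ⟦ S e ⟧ * ⟦ X (end e false) ⟧ + ⟦ S e ⟧ * ⟦ X (end e true) ⟧))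
      ≡⟨ cong parity (sum-handshake end (λ v → ⟦ X v ⟧) (λ e _ → ⟦ S e ⟧)) ⟨
    parity (sum (λ v → ⟦ X v ⟧ * degreeIn S v))
      ≡⟨ cong parity (sum-cong-≗ λ v → trans (cong (⟦ X v ⟧ *_) (regular v)) (*-comm ⟦ X v ⟧ d)) ⟩
    parity (sum (λ v → d * ⟦ X v ⟧))
      ≡⟨ cong parity (*-distribˡ-sum d (λ v → ⟦ X v ⟧)) ⟨
    parity (d * ∣ X ∣ᵇ)
      ≡⟨ *-homo-* d ∣ X ∣ᵇ ⟩
    parity d ℙ.* parity ∣ X ∣ᵇ
      ≡⟨ cong (ℙ._* parity ∣ X ∣ᵇ) d-even ⟩
    0ℙ ∎
    where
    open ≡-Reasoning
    crossing : ∀ a x y → parity ⟦ a ∧ (x xor y) ⟧ ≡ parity (⟦ a ⟧ * ⟦ x ⟧ + ⟦ a ⟧ * ⟦ y ⟧)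
    crossing false x     y     = refl
    crossing true  false false = refl
    crossing true  false true  = refl
    crossing true  true  false = refl
    crossing true  true  true  = refl

  degreeIn-complement : ∀ S v → degreeIn (not ∘ S) v + degreeIn S v ≡ degreeIn (λ _ → true) v
  degreeIn-complement S v = trans (sym (∑-distrib-+ (part (not ∘ S)) (part S))) (sum-cong-≗ together)
    where
    part : (Fin m → Bool) → Fin m → ℕ
    part S e = ⟦ S e ⟧ * δ (end e false) v + ⟦ S e ⟧ * δ (end e true) v
    together : ∀ e → part (not ∘ S) e + part S e ≡ part (λ _ → true) e
    together e with S e
    ... | true  = refl
    ... | false = +-identityʳ _

-- Multigraphs, incidence and edge cuts.

endpoint : (G : Graph) → Fin (Graph.m G) → Bool → Fin (Graph.n G)
endpoint G e false = proj₁ (ends G e)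
endpoint G e true  = proj₂ (ends G e)

incidence : (G : Graph) → Fin (Graph.m G) → Fin (Graph.n G) → ℕ
incidence G e v = δ (endpoint G e false) v + δ (endpoint G e true) v

-- A loop would be the only case where the sum exceeds the disjunction.
incident≡ : ∀ G e v → ⟦ incident G e v ⟧ ≡ incidence G e v
incident≡ G e v with proj₁ (ends G e) ≟ v | proj₂ (ends G e) ≟ v
... | yes p | yes q = contradiction (trans p (sym q)) (loopless G e)
... | yes _ | no _  = refl
... | no _  | yes _ = refl
... | no _  | no _  = refl

degree≡ : ∀ G v → degree G v ≡ EdgeSet.degreeIn (endpoint G) (λ _ → true) v
degree≡ G v = trans (∑ℕ≡sum (λ e → ⟦ incident G e v ⟧)) (sum-cong-≗ λ e → trans (incident≡ G e v)
  (sym (cong₂ _+_ (*-identityˡ (δ (endpoint G e false) v)) (*-identityˡ (δ (endpoint G e true) v)))))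

walk-constant : ∀ {G ok} (X : Fin (Graph.n G) → Bool) →
  (∀ e → ok e → X (endpoint G e false) ≡ X (endpoint G e true)) →
  ∀ {u v} → Walk G ok u v → X u ≡ X v
walk-constant X same here            = refl
walk-constant X same (fwd e ok walk) = trans (same e ok) (walk-constant X same walk)
walk-constant X same (bwd e ok walk) = trans (sym (same e ok)) (walk-constant X same walk)

crosses : (G : Graph) → (Fin (Graph.n G) → Bool) → Fin (Graph.m G) → Bool
crosses G X e = X (endpoint G e false) xor X (endpoint G e true)

-- If only `f` crossed, `X` would be constant along walks avoiding `f`, and such a walk joins the
-- ends of `f`.
boundary≢1 : ∀ G → TwoEdgeConnected G → ∀ X → EdgeSet.boundary (endpoint G) (λ _ → true) X ≢ 1
boundary≢1 G (_ , bridgeless) X one with any? (λ e → crosses G X e Data.Bool.≟ true)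
... | no none = contradiction (trans (sym one) (sum-zero none′)) λ ()
  where
  none′ : ∀ e → ⟦ crosses G X e ⟧ ≡ 0
  none′ e with crosses G X e in eq
  ... | true  = contradiction (e , eq) none
  ... | false = refl
... | yes (f , f-crosses) = contradiction
  (trans (sym f-crosses) (trans (cong (_xor X (endpoint G f true)) ends-agree) (xor-same (X (endpoint G f true)))))
  λ ()
  where
  only : ∀ e → e ≢ f → crosses G X e ≢ true
  only e e≢f e-crosses = <-irrefl refl (≤-trans
    (subst (_≤ sum (⟦_⟧ ∘ crosses G X))
      (trans (∑-distrib-+ (δ e) (δ f)) (cong₂ _+_ (sum-δ e) (sum-δ f))) (sum-mono below))
    (≤-reflexive one))
    where
    below : ∀ i → δ e i + δ f i ≤ ⟦ crosses G X i ⟧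
    below i with e ≟ i | f ≟ i
    ... | yes p    | yes q    = contradiction (trans p (sym q)) e≢f
    ... | yes refl | no _     = ≤-reflexive (sym (cong ⟦_⟧ e-crosses))
    ... | no _     | yes refl = ≤-reflexive (sym (cong ⟦_⟧ f-crosses))
    ... | no _     | no _     = z≤n
  xor-false : ∀ x y → x xor y ≢ true → x ≡ y
  xor-false false false _ = refl
  xor-false false true  h = contradiction refl h
  xor-false true  false h = contradiction refl h
  xor-false true  true  _ = refl
  ends-agree : X (endpoint G f false) ≡ X (endpoint G f true)
  ends-agree = walk-constant X (λ e e≢f → xor-false _ _ (only e e≢f)) (bridgeless f _ _)

-- Arithmetic of the admissible degrees.

two-three-form : ∀ u → u ≢ 1 → ∃₂ λ a b → u ≡ 3 * a + 2 * b
two-three-form 0 _ = 0 , 0 , refl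
two-three-form 1 u≢1 = contradiction refl u≢1
two-three-form (suc (suc u)) _ with u Data.Nat.≟ 1
... | yes refl = 1 , 0 , refl
... | no u≢1 with two-three-form u u≢1
...   | a , b , refl = a , suc b , lem a b
  where lem : ∀ a b → 2 + (3 * a + 2 * b) ≡ 3 * a + 2 * suc b
        lem = solve-∀

-- With `r = 2u + 3`, degree 5 is `u = 1`, the only natural number that is not a sum of twos and
-- threes.
odd-degree-form : ∀ r → 3 ≤ r → Odd r → r ≢ 5 → ∃₂ λ a b → r ≡ 6 * a + 4 * b + 3
odd-degree-form r 3≤r (zero , refl) _ = contradiction 3≤r λ { (s≤s ()) }
odd-degree-form r 3≤r (suc u , refl) r≢5 with two-three-form u (λ { refl → r≢5 refl })
... | a , b , refl = a , b , lem a b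
  where lem : ∀ a b → 2 * suc (3 * a + 2 * b) + 1 ≡ 6 * a + 4 * b + 3
        lem = solve-∀

parity-2* : ∀ k → parity (2 * k) ≡ 0ℙ
parity-2* k = *-homo-* 2 k

-- Construction of the flow.

module Flow (G : Graph) (connected : TwoEdgeConnected G) (a b : ℕ)
            (regular : Regular (6 * a + 4 * b + 3) G) where

  end : Fin (Graph.m G) → Bool → Fin (Graph.n G)
  end = endpoint G

  open EdgeSet end

  degree-all : ∀ v → degreeIn (λ _ → true) v ≡ 6 * a + 4 * b + 3
  degree-all v = trans (sym (degree≡ G v)) (regular v)

  s : ℕ
  s = 2 * a + 2 * b + 1

  regular₁ : ∀ v → degreeIn (λ _ → true) v ≡ s + suc (4 * a + 2 * b + 1)
  regular₁ v = trans (degree-all v) (lem a b)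
    where lem : ∀ a b → 6 * a + 4 * b + 3 ≡ (2 * a + 2 * b + 1) + suc (4 * a + 2 * b + 1)
          lem = solve-∀

  complement-even : parity (suc (4 * a + 2 * b + 1)) ≡ 0ℙ
  complement-even = trans (cong parity (lem a b)) (parity-2* (2 * a + b + 1))
    where lem : ∀ a b → suc (4 * a + 2 * b + 1) ≡ 2 * (2 * a + b + 1)
          lem = solve-∀

  odd-boundary₁ : ∀ X → parity (boundary (λ _ → true) X) ≡ 1ℙ →
                  s + suc (4 * a + 2 * b + 1) ≤ s * boundary (λ _ → true) X
  odd-boundary₁ X odd = begin
    -- The slack `2 * b` is `3 * s` minus the degree.
    s + suc (4 * a + 2 * b + 1)     ≤⟨ m≤m+n _ (2 * b) ⟩
    s + suc (4 * a + 2 * b + 1) + 2 * b ≡⟨ lem a b ⟩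
    s * 3                           ≤⟨ *-monoʳ-≤ s (3≤ _ odd (boundary≢1 G connected X)) ⟩
    s * boundary (λ _ → true) X     ∎
    where
    open ≤-Reasoning
    3≤ : ∀ k → parity k ≡ 1ℙ → k ≢ 1 → 3 ≤ k
    3≤ 1 _ k≢1 = contradiction refl k≢1
    3≤ (suc (suc (suc k))) _ _ = s≤s (s≤s (s≤s z≤n))
    lem : ∀ a b → (2 * a + 2 * b + 1) + suc (4 * a + 2 * b + 1) + 2 * b ≡ (2 * a + 2 * b + 1) * 3
    lem = solve-∀

  s-factor : ∃[ F ] (∀ e → F e ≡ true → true ≡ true) × (∀ v → degreeIn F v ≡ s)
  s-factor = Factor.exists-factor end (λ _ → true) s (4 * a + 2 * b + 1) regular₁ complement-even odd-boundary₁

  F : Fin (Graph.m G) → Bool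
  F = proj₁ s-factor

  F-degree : ∀ v → degreeIn F v ≡ s
  F-degree = proj₂ (proj₂ s-factor)

  rest : Fin (Graph.m G) → Bool
  rest = not ∘ F

  rest-degree : ∀ v → degreeIn rest v ≡ suc (4 * a + 2 * b + 1)
  rest-degree v = +-cancelʳ-≡ s _ _ (begin
    degreeIn rest v + s             ≡⟨ cong (degreeIn rest v +_) (F-degree v) ⟨
    degreeIn rest v + degreeIn F v  ≡⟨ degreeIn-complement end F v ⟩
    degreeIn (λ _ → true) v         ≡⟨ regular₁ v ⟩
    s + suc (4 * a + 2 * b + 1)     ≡⟨ +-comm s _ ⟩
    suc (4 * a + 2 * b + 1) + s     ∎)
    where open ≡-Reasoning

  regular₂ : ∀ v → degreeIn rest v ≡ 2 * b + suc (4 * a + 1)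
  regular₂ v = trans (rest-degree v) (lem a b)
    where lem : ∀ a b → suc (4 * a + 2 * b + 1) ≡ 2 * b + suc (4 * a + 1)
          lem = solve-∀

  complement-even₂ : parity (suc (4 * a + 1)) ≡ 0ℙ
  complement-even₂ = trans (cong parity (lem a)) (parity-2* (2 * a + 1))
    where lem : ∀ a → suc (4 * a + 1) ≡ 2 * (2 * a + 1)
          lem = solve-∀

  -- `rest` is regular of even degree, so it has no odd boundary and the cut condition holds
  -- vacuously.
  rest-factor : ∃[ D ] (∀ e → D e ≡ true → rest e ≡ true) × (∀ v → degreeIn D v ≡ 2 * b)
  rest-factor = Factor.exists-factor end rest (2 * b) (4 * a + 1) regular₂ complement-even₂ λ X odd →
    contradiction (trans (sym odd) (even-regular-boundary end {S = rest} rest-degree complement-even X)) λ ()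

  D : Fin (Graph.m G) → Bool
  D = proj₁ rest-factor

  D⊆rest : ∀ e → D e ≡ true → rest e ≡ true
  D⊆rest = proj₁ (proj₂ rest-factor)

  D-degree : ∀ v → degreeIn D v ≡ 2 * b
  D-degree = proj₂ (proj₂ rest-factor)

  -- As `D` lies in `rest`, its edges collect two negative units and the other edges of `rest` one.
  up down : Fin (Graph.m G) → ℕ
  up e = 2 * ⟦ F e ⟧
  down e = ⟦ rest e ⟧ + ⟦ D e ⟧

  ω : Fin (Graph.m G) → ℤ
  ω e = up e ⊖ down e

  ω-bounds : ∀ e → 1 ≤ ℤ.∣ ω e ∣ × ℤ.∣ ω e ∣ < 3
  ω-bounds e = bounds (F e) (D e) (D⊆rest e)
    where
    bounds : ∀ f d → (d ≡ true → not f ≡ true) →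
      let k = ℤ.∣ (2 * ⟦ f ⟧) ⊖ (⟦ not f ⟧ + ⟦ d ⟧) ∣ in 1 ≤ k × k < 3
    bounds true  true  disjoint = contradiction (disjoint refl) λ ()
    bounds true  false _ = s≤s z≤n , ≤-refl
    bounds false true  _ = s≤s z≤n , ≤-refl
    bounds false false _ = ≤-refl , n≤1+n 2

  at : (Fin (Graph.m G) → ℕ) → Fin (Graph.n G) → ℕ
  at f v = sum λ e → incidence G e v * f e

  at-degree : ∀ S v → at (⟦_⟧ ∘ S) v ≡ degreeIn S v
  at-degree S v = sum-cong-≗ λ e → trans (*-comm (incidence G e v) ⟦ S e ⟧) (*-distribˡ-+ ⟦ S e ⟧ (δ (end e false) v) _)

  -- The degrees of `F` and `D` are chosen for this: both totals are 4a + 4b + 2.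
  up≡down : ∀ v → at up v ≡ at down v
  up≡down v = begin
    at up v
      ≡⟨ sum-cong-≗ (λ e → swap (incidence G e v) ⟦ F e ⟧) ⟩
    sum (λ e → 2 * (incidence G e v * ⟦ F e ⟧))
      ≡⟨ *-distribˡ-sum 2 (λ e → incidence G e v * ⟦ F e ⟧) ⟨
    2 * at (⟦_⟧ ∘ F) v
      ≡⟨ cong (2 *_) (trans (at-degree F v) (F-degree v)) ⟩
    2 * s
      ≡⟨ lem a b ⟩
    suc (4 * a + 2 * b + 1) + 2 * b
      ≡⟨ cong₂ _+_ (trans (at-degree rest v) (rest-degree v)) (trans (at-degree D v) (D-degree v)) ⟨
    at (⟦_⟧ ∘ rest) v + at (⟦_⟧ ∘ D) v
      ≡⟨ ∑-distrib-+ (λ e → incidence G e v * ⟦ rest e ⟧) (λ e → incidence G e v * ⟦ D e ⟧) ⟨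
    sum (λ e → incidence G e v * ⟦ rest e ⟧ + incidence G e v * ⟦ D e ⟧)
      ≡⟨ sum-cong-≗ (λ e → *-distribˡ-+ (incidence G e v) ⟦ rest e ⟧ ⟦ D e ⟧) ⟨
    at down v ∎
    where
    open ≡-Reasoning
    swap : ∀ k x → k * (2 * x) ≡ 2 * (k * x)
    swap = solve-∀
    lem : ∀ a b → 2 * (2 * a + 2 * b + 1) ≡ suc (4 * a + 2 * b + 1) + 2 * b
    lem = solve-∀

  ω-at : ∀ v e → (if incident G e v then ω e else ℤ.0ℤ) ≡ (incidence G e v * up e) ⊖ (incidence G e v * down e)
  ω-at v e = trans (weigh (incident G e v) (up e) (down e))
                   (cong (λ k → (k * up e) ⊖ (k * down e)) (incident≡ G e v))
    where
    weigh : ∀ b x y → (if b then x ⊖ y else ℤ.0ℤ) ≡ (⟦ b ⟧ * x) ⊖ (⟦ b ⟧ * y)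
    weigh true  x y = sym (cong₂ _⊖_ (*-identityˡ x) (*-identityˡ y))
    weigh false x y = refl

  isZeroSumFlow : IsSumFlow G ℤ.0ℤ 3 ω
  isZeroSumFlow = ω-bounds , λ v → trans
    (∑ℤ-⊖ (λ e → incidence G e v * up e) (λ e → incidence G e v * down e) (ω-at v))
    (trans (cong (_⊖ at down v) (up≡down v)) (n⊖n≡0 (at down v)))

theorem10 : (r : ℕ) → 3 ≤ r → Odd r → ¬ (r ≡ 5) →
    (G : Graph) → TwoEdgeConnected G → Regular r G → HasZeroSumFlow 3 G
theorem10 r 3≤r r-odd r≢5 G connected regular with odd-degree-form r 3≤r r-odd r≢5
... | a , b , refl = Flow.ω G connected a b regular , Flow.isZeroSumFlow G connected a b regular
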